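{- Let $w_1,w_2,w_3$ be any odd positive integers. Then for every integer $n\ge 0$ and every $y_1\in\mathbb{Z}_p$, the following three expressions are equal: \begin{align*} &\sum_{k+l+m=n}\binom{n}{k,l,m}E_{k,\chi}(w_1y_1)T_l(w_2d-1,\chi)T_m(w_3d-1,\chi)\,w_{1}^{l+m}w_{2}^{k+m}w_{3}^{k+l}\\ =&\sum_{k+l+m=n}\binom{n}{k,l,m}E_{k,\chi}(w_2y_1)T_l(w_3d-1,\chi)T_m(w_1d-1,\chi)\,w_{2}^{l+m}w_{3}^{k+m}w_{1}^{k+l}\\ =&\sum_{k+l+m=n}\binom{n}{k,l,m}E_{k,\chi}(w_3y_1)T_l(w_1d-1,\chi)T_m(w_2d-1,\chi)\,w_{3}^{l+m}w_{1}^{k+m}w_{2}^{k+l}. \end{align*} Here each sum is over all nonnegative integers $k,l,m$ with $k+l+m=n$.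
   Context: $p$ is a fixed odd prime, $\mathbb{Z}_p$ is the ring of $p$-adic integers, and $\mathbb{C}_p$ is the completion of an algebraic closure of $\mathbb{Q}_p$. $d$ is a fixed odd positive integer and $\chi$ is a (primitive) Dirichlet character of conductor $d$, with values in $\overline{\mathbb{Q}}$, regarded as $\mathbb{C}_p$-valued through a fixed embedding $\overline{\mathbb{Q}}\to\mathbb{C}_p$; as usual $\chi(a)=0$ when $\gcd(a,d)>1$ (and $\chi\equiv 1$ if $d=1$). The generalized Euler polynomials $E_{n,\chi}(x)$ attached to $\chi$ are the polynomials in $x$ defined by $$\frac{2e^{xt}}{e^{dt}+1}\sum_{a=0}^{d-1}(-1)^a\chi(a)e^{at}=\sum_{n=0}^{\infty}E_{n,\chi}(x)\frac{t^n}{n!}.$$ For integers $k,n\ge 0$, the $k$th alternating generalized power sum attached to $\chi$ is $T_k(n,\chi)=\sum_{a=0}^{n}(-1)^a\chi(a)a^k$, with the convention $0^0=1$. The multinomial coefficient is $\binom{n}{k,l,m}=\frac{n!}{k!\,l!\,m!}$. -}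

module Defs where

open import Algebra.Apartness.Bundles using (HeytingField; HeytingCommutativeRing)
open import Algebra.Bundles using (CommutativeRing)
open import Algebra.Bundles.Raw using (RawRing)
import Algebra.Definitions.RawSemiring as RawSemiringDefs
open import Algebra.Morphism.Bundles using (RingHomomorphism)
open import Data.Fin.Base using (toℕ)
open import Data.Integer.Base as ℤ using (ℤ; +_; 1ℤ)
import Data.Integer.Coprimality as ℤ using (Coprime)
import Data.Integer.Divisibility as ℤ using (_∣_)
open import Data.List.Base as List using (List; []; _∷_; _++_; foldr)
open import Data.Nat.Base as ℕ using (ℕ; zero; suc; _∸_; _!; NonZero)
import Data.Nat.Divisibility as ℕ using (_∣_)
open import Data.Nat.Properties using (_!≢0; m*n≢0)
open import Data.Product.Base using (Σ; ∃; _×_)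
open import Data.Rational.Base as ℚ using (ℚ; 0ℚ; 1ℚ; ½)
import Data.Rational.Properties as ℚ using (heytingField)
open import Data.Vec.Base as Vec using (Vec; []; _∷_)
open import Level using (Level; _⊔_) renaming (suc to lsuc)
open import Relation.Binary.PropositionalEquality.Core using (_≡_)
open import Relation.Nullary.Negation using (¬_)

private variable
  c ℓ₁ ℓ₂ c′ ℓ₁′ ℓ₂′ : Level

------------------------------------------------------------------------
-- Polynomials and formal power series

module _ {c ℓ} (R : RawRing c ℓ) where
  open RawRing R
  open RawSemiringDefs rawSemiring renaming (_×_ to _·_)

  fromℕ : ℕ → Carrier
  fromℕ n = n · 1#

  -- ∑[0≤ n ] f = f 0 + … + f n,  ∑[ n ] f = f 0 + … + f (n - 1)
  ∑[_] ∑[0≤_] : ℕ → (ℕ → Carrier) → Carrier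
  ∑[ n ]   f = sum {n} (λ i → f (toℕ i))
  ∑[0≤ n ] f = ∑[ suc n ] f

  -- The sum over all triples of natural numbers with k + l + m = n.
  ∑₃ : ℕ → (ℕ → ℕ → ℕ → Carrier) → Carrier
  ∑₃ n f = ∑[0≤ n ] λ k → ∑[0≤ n ∸ k ] λ l → f k l (n ∸ k ∸ l)

  -- Coefficient lists, constant term first.  Trailing zeros are allowed;
  -- equality is equality of all coefficients.
  Poly : Set c
  Poly = List Carrier

  coeff : Poly → ℕ → Carrier
  coeff []      _       = 0#
  coeff (a ∷ f) zero    = a
  coeff (a ∷ f) (suc n) = coeff f n

  addPoly : Poly → Poly → Poly
  addPoly []      g       = g
  addPoly (a ∷ f) []      = a ∷ f
  addPoly (a ∷ f) (b ∷ g) = a + b ∷ addPoly f g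

  mulPoly : Poly → Poly → Poly
  mulPoly []      g = []
  mulPoly (a ∷ f) g = addPoly (List.map (a *_) g) (0# ∷ mulPoly f g)

  polyRing : RawRing c ℓ
  polyRing = record
    { Carrier = Poly
    ; _≈_     = λ f g → ∀ n → coeff f n ≈ coeff g n
    ; _+_     = addPoly
    ; _*_     = mulPoly
    ; -_      = List.map (-_)
    ; 0#      = []
    ; 1#      = 1# ∷ []
    }

  constPoly : Carrier → Poly
  constPoly a = a ∷ []

  X : Poly
  X = 0# ∷ 1# ∷ []

  eval : Poly → Carrier → Carrier
  eval f x = foldr (λ a v → a + x * v) 0# f

  -- The monic polynomial of degree `length f` with lower coefficients f.
  monic : Poly → Poly
  monic f = f ++ 1# ∷ []

  Series : Set c
  Series = ℕ → Carrier

  constSeries : Carrier → Series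
  constSeries a zero    = a
  constSeries a (suc _) = 0#

  seriesRing : RawRing c ℓ
  seriesRing = record
    { Carrier = Series
    ; _≈_     = λ f g → ∀ n → f n ≈ g n
    ; _+_     = λ f g n → f n + g n
    ; _*_     = λ f g n → ∑[0≤ n ] λ i → f i * g (n ∸ i)
    ; -_      = λ f n → - f n
    ; 0#      = λ _ → 0#
    ; 1#      = constSeries 1#
    }

  -- For u the inverse of the constant term of g, divide u f g is the
  -- quotient h = f / g, given by
  --   h n = u (f n - ∑_{i<n} g (i+1) h (n-1-i)).
  -- quotientCoeffs u f g n lists h (n-1), …, h 0, in this order.
  quotientCoeffs : Carrier → Series → Series → (n : ℕ) → Vec Carrier n
  quotientCoeffs u f g zero    = []
  quotientCoeffs u f g (suc n) =
    u * (f n + - sum (λ i → g (suc (toℕ i)) * Vec.lookup h i)) ∷ h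
    where h = quotientCoeffs u f g n

  divide : Carrier → Series → Series → Series
  divide u f g n = Vec.head (quotientCoeffs u f g (suc n))

  -- exp ι a = e^{at}, where ι : ℚ → R gives the ℚ-algebra structure.
  exp : (ℚ → Carrier) → Carrier → Series
  exp ι a n = ι ((1ℤ ℚ./ n !) {{n !≢0}}) * a ^ n

multinomial : (n k l m : ℕ) → ℚ
multinomial n k l m = + (n !) ℚ./ (k ! ℕ.* l ! ℕ.* m !)
  where instance
    _ = k !≢0
    _ = l !≢0
    _ = m !≢0
    _ = m*n≢0 (k !) (l !)
    _ = m*n≢0 (k ! ℕ.* l !) (m !)

------------------------------------------------------------------------
-- Generalized Euler polynomials and alternating power sums

-- T k n = ∑_{a=0}^{n} (-1)^a χ(a) a^k; here x ^ 0 is 1# for every x.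
altPowerSum : ∀ {c ℓ} (K : RawRing c ℓ) → (ℤ → RawRing.Carrier K) →
              (k n : ℕ) → RawRing.Carrier K
altPowerSum K χ k n = ∑[0≤_] K n λ a → (- 1#) ^ a * χ (+ a) * fromℕ K a ^ k
  where
  open RawRing K
  open RawSemiringDefs rawSemiring using (_^_)

module _ {c ℓ} (K : RawRing c ℓ) (ι : ℚ → RawRing.Carrier K)
         (d : ℕ) (χ : ℤ → RawRing.Carrier K) where

  -- 2e^{xt} / (e^{dt} + 1) · ∑_{a<d} (-1)^a χ(a) e^{at}  ∈  K[x][[t]]
  eulerSeries : Series (polyRing K)
  eulerSeries =
    divide K[x] (const (ι ½))
      (fromℕ K[x][[t]] 2 * e^ X K)
      (e^ fromℕ K[x] d + 1#)
    * ∑[_] K[x][[t]] d λ a →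
        (- 1#) ^ a * constSeries K[x] (const (χ (+ a))) * e^ fromℕ K[x] a
    where
    K[x] = polyRing K
    K[x][[t]] = seriesRing K[x]
    const = constPoly K
    open RawRing K[x][[t]]
    open RawSemiringDefs rawSemiring using (_^_)
    infix 9 e^_
    e^_ : Poly K → Series K[x]
    e^_ = exp K[x] (λ q → const (ι q))

  eulerPoly : ℕ → Poly K
  eulerPoly n = fromℕ K[x] (n !) * eulerSeries n
    where
    K[x] = polyRing K
    open RawRing K[x]

------------------------------------------------------------------------
-- Fields and valuations

rawRing : HeytingField c ℓ₁ ℓ₂ → RawRing c ℓ₁
rawRing F = CommutativeRing.rawRing
  (HeytingCommutativeRing.commutativeRing (HeytingField.heytingCommutativeRing F))

∣_∣ : HeytingField c ℓ₁ ℓ₂ → Set c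
∣ F ∣ = HeytingField.Carrier F

-- Field homomorphisms; they preserve _#_, since this is invertibility of
-- the difference.
FieldHom : HeytingField c ℓ₁ ℓ₂ → HeytingField c′ ℓ₁′ ℓ₂′ → Set _
FieldHom F G = RingHomomorphism (rawRing F) (rawRing G)

map : {F : HeytingField c ℓ₁ ℓ₂} {G : HeytingField c′ ℓ₁′ ℓ₂′} →
      FieldHom F G → ∣ F ∣ → ∣ G ∣
map = RingHomomorphism.⟦_⟧

record IsAlgebraicClosure {F : HeytingField c ℓ₁ ℓ₂} {G : HeytingField c′ ℓ₁′ ℓ₂′}
                          (φ : FieldHom F G) : Set (c ⊔ c′ ⊔ ℓ₁′) where
  open HeytingField G
  field
    algebraic : ∀ x → ∃ λ (f : Poly (rawRing F)) →
      eval (rawRing G) (List.map (map {F = F} {G} φ) (monic (rawRing F) f)) x ≈ 0#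
    closed    : ∀ a f → ∃ λ x →
      eval (rawRing G) (monic (rawRing G) (a ∷ f)) x ≈ 0#

-- Non-archimedean valuations of rank one, written additively:
-- |x| = p^{- ord x}.  The value group lies in ℚ for all fields up to ℂₚ.
record Valuation (F : HeytingField c ℓ₁ ℓ₂) : Set (c ⊔ ℓ₁ ⊔ ℓ₂) where
  open HeytingField F
  field
    ord      : ∀ {x} → x # 0# → ℚ
    ord-cong : ∀ {x y} (x#0 : x # 0#) (y#0 : y # 0#) → x ≈ y → ord x#0 ≡ ord y#0
    ord-*    : ∀ {x y} (x#0 : x # 0#) (y#0 : y # 0#) (xy#0 : x * y # 0#) →
               ord xy#0 ≡ ord x#0 ℚ.+ ord y#0
    ord-+    : ∀ {x y} (x#0 : x # 0#) (y#0 : y # 0#) (x+y#0 : x + y # 0#) →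
               ord x#0 ℚ.⊓ ord y#0 ℚ.≤ ord x+y#0

  -- ord x ≥ q, with ord 0 = ∞.
  ord≥ : ℚ → Carrier → Set ℓ₂
  ord≥ q x = (x#0 : x # 0#) → q ℚ.≤ ord x#0

  _⟶_ : (ℕ → Carrier) → Carrier → Set ℓ₂
  s ⟶ x = ∀ q → ∃ λ N → ∀ n → N ℕ.≤ n → ord≥ q (s n - x)

  Cauchy : (ℕ → Carrier) → Set ℓ₂
  Cauchy s = ∀ q → ∃ λ N → ∀ m n → N ℕ.≤ m → N ℕ.≤ n → ord≥ q (s m - s n)

module _ {F : HeytingField c ℓ₁ ℓ₂} {G : HeytingField c′ ℓ₁′ ℓ₂′}
         (v : Valuation F) (w : Valuation G) (φ : FieldHom F G) where
  private
    module F = HeytingField F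
    module G = HeytingField G
    module v = Valuation v
    module w = Valuation w

  Isometric : Set (c ⊔ ℓ₂ ⊔ ℓ₂′)
  Isometric = ∀ {x} (x#0 : x F.# F.0#) (φx#0 : map {F = F} {G} φ x G.# G.0#) →
              w.ord φx#0 ≡ v.ord x#0

  record IsCompletion : Set (c ⊔ ℓ₂ ⊔ c′ ⊔ ℓ₂′) where
    field
      isometric : Isometric
      dense     : ∀ x q → ∃ λ y → w.ord≥ q (map {F = F} {G} φ y G.- x)
      complete  : ∀ s → w.Cauchy s → ∃ λ x → s w.⟶ x

-- The p-adic valuation on ℚ.
record IsPadic (p : ℕ) (v : Valuation ℚ.heytingField) : Set where
  open Valuation v
  field
    ord-p    : ∀ p#0 → ord {+ p ℚ./ 1} p#0 ≡ 1ℚ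
    ord-unit : ∀ a a#0 → ¬ (+ p ℤ.∣ a) → ord {a ℚ./ 1} a#0 ≡ 0ℚ

-- ℚ ⊂ ℚₚ ⊂ ℚ̄ₚ ⊂ ℂₚ.  Each step is unique up to isometric isomorphism.
record PadicTower (p : ℕ) (c ℓ₁ ℓ₂ : Level) : Set (lsuc (c ⊔ ℓ₁ ⊔ ℓ₂)) where
  field
    vℚ           : Valuation ℚ.heytingField
    vℚ-padic     : IsPadic p vℚ

    ℚₚ           : HeytingField c ℓ₁ ℓ₂
    vℚₚ          : Valuation ℚₚ
    ℚ→ℚₚ         : FieldHom ℚ.heytingField ℚₚ
    ℚₚ-complete  : IsCompletion vℚ vℚₚ ℚ→ℚₚ

    ℚ̄ₚ           : HeytingField c ℓ₁ ℓ₂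
    vℚ̄ₚ          : Valuation ℚ̄ₚ
    ℚₚ→ℚ̄ₚ        : FieldHom ℚₚ ℚ̄ₚ
    ℚ̄ₚ-closure   : IsAlgebraicClosure {F = ℚₚ} {ℚ̄ₚ} ℚₚ→ℚ̄ₚ
    ℚ̄ₚ-isometric : Isometric vℚₚ vℚ̄ₚ ℚₚ→ℚ̄ₚ

    ℂₚ           : HeytingField c ℓ₁ ℓ₂
    vℂₚ          : Valuation ℂₚ
    ℚ̄ₚ→ℂₚ        : FieldHom ℚ̄ₚ ℂₚ
    ℂₚ-complete  : IsCompletion vℚ̄ₚ vℂₚ ℚ̄ₚ→ℂₚ

  ℤₚ : Set (c ⊔ ℓ₂)
  ℤₚ = Σ ∣ ℚₚ ∣ (Valuation.ord≥ vℚₚ 0ℚ)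

  ℚₚ→ℂₚ : ∣ ℚₚ ∣ → ∣ ℂₚ ∣
  ℚₚ→ℂₚ x = map {F = ℚ̄ₚ} {ℂₚ} ℚ̄ₚ→ℂₚ (map {F = ℚₚ} {ℚ̄ₚ} ℚₚ→ℚ̄ₚ x)

  ℚ→ℂₚ : ℚ → ∣ ℂₚ ∣
  ℚ→ℂₚ x = ℚₚ→ℂₚ (map {F = ℚ.heytingField} {ℚₚ} ℚ→ℚₚ x)

  ℤₚ→ℂₚ : ℤₚ → ∣ ℂₚ ∣
  ℤₚ→ℂₚ y = ℚₚ→ℂₚ (Σ.proj₁ y)

record AlgebraicClosureOfℚ (c ℓ₁ ℓ₂ : Level) : Set (lsuc (c ⊔ ℓ₁ ⊔ ℓ₂)) where
  field
    ℚ̄         : HeytingField c ℓ₁ ℓ₂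
    ℚ→ℚ̄       : FieldHom ℚ.heytingField ℚ̄
    ℚ̄-closure : IsAlgebraicClosure {F = ℚ.heytingField} {ℚ̄} ℚ→ℚ̄

------------------------------------------------------------------------
-- Dirichlet characters

record DirichletCharacter (F : HeytingField c ℓ₁ ℓ₂) (d : ℕ) : Set (c ⊔ ℓ₁) where
  open HeytingField F
  field
    χ          : ℤ → Carrier
    χ-periodic : ∀ a b → + d ℤ.∣ a ℤ.- b → χ a ≈ χ b
    χ-1        : χ 1ℤ ≈ 1#
    χ-*        : ∀ a b → χ (a ℤ.* b) ≈ χ a * χ b
    χ-0        : ∀ a → ¬ ℤ.Coprime a (+ d) → χ a ≈ 0#

  FactorsThrough : ℕ → Set ℓ₁
  FactorsThrough e = ∀ a b → ℤ.Coprime a (+ d) → ℤ.Coprime b (+ d) →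
                     + e ℤ.∣ a ℤ.- b → χ a ≈ χ b

  -- The conductor is d.
  Primitive : Set ℓ₁
  Primitive = ∀ e → e ℕ.∣ d → FactorsThrough e → e ≡ d

{-# OPTIONS --safe #-}

-- With A = ∑_{a<d} (-1)^a χ(a) e^{at}, the series ∑ E_k(x) t^k / k! is 2 e^{xt} A(t) / (e^{dt} + 1).
-- Since d and w are odd and χ has period d, ∑_{a<wd} (-1)^a χ(a) e^{at} is a geometric
-- sum, namely A(t) (e^{wdt} + 1) / (e^{dt} + 1).  Hence each of the three expressions is n!
-- times the coefficient of t^n in
--   2 e^{w₁w₂w₃yt} A(w₂w₃t) A(w₃w₁t) A(w₁w₂t) (e^{dw₁w₂w₃t} + 1)²
--     / ((e^{dw₂w₃t} + 1) (e^{dw₃w₁t} + 1) (e^{dw₁w₂t} + 1)),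
-- which is symmetric in w₁, w₂, w₃.

module Submission where

open import Defs hiding (rawRing)
open import Algebra.Apartness.Bundles using (HeytingField; HeytingCommutativeRing)
open import Algebra.Bundles using (CommutativeRing)
open import Algebra.Bundles.Raw using (RawRing)
import Algebra.Definitions.RawSemiring as RawSemiringDefs
open import Algebra.Morphism.Bundles using (RingHomomorphism)
import Algebra.Morphism.Construct.Composition as Composition
import Algebra.Morphism.Construct.Identity as Identity
open import Algebra.Morphism.Structures using (IsRingHomomorphism)
import Algebra.Properties.CommutativeMonoid.Sum as CommutativeMonoidSum
import Algebra.Properties.CommutativeSemiring.Binomial as Binomial
import Algebra.Properties.CommutativeSemiring.Exp as CommutativeExp
import Algebra.Properties.Ring as RingProperties
import Algebra.Properties.Semiring.Exp as Exp
import Algebra.Properties.Semiring.Mult as Mult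
import Algebra.Properties.Semiring.Sum as Sum
import Algebra.Solver.Ring.NaturalCoefficients.Default as Solver
open import Data.Fin.Base using (Fin; zero; suc; toℕ)
open import Data.Fin.Properties using (toℕ≤pred[n])
open import Data.Integer.Base as ℤ using (ℤ; +_; 1ℤ)
import Data.Integer.Divisibility as ℤ using (_∣_)
import Data.Integer.Properties as ℤ
import Data.List.Base as List
open import Data.List.Base using ([]; _∷_)
open import Data.Nat.Base as ℕ using (ℕ; zero; suc; _∸_; _!; NonZero; _≤_)
  renaming (_+_ to _+ℕ_; _*_ to _*ℕ_)
open import Data.Nat.Combinatorics using (nCk≡n!/k![n-k]!; k![n∸k]!∣n!) renaming (_C_ to _choose_)
open import Data.Nat.DivMod using (m/n*n≡m)
open import Data.Nat.Divisibility using (divides; ∣-refl; ∣-reflexive; ∣m∣n⇒∣m+n) renaming (_∣_ to _∣ℕ_)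
open import Data.Nat.Primality using (Prime)
import Data.Nat.Properties as ℕ
open import Data.Product.Base using (_×_; _,_; ∃)
open import Data.Rational.Base as ℚ using (ℚ; ½; toℚᵘ)
import Data.Rational.Properties as ℚ
open import Data.Rational.Unnormalised.Base as ℚᵘ using (mkℚᵘ; *≡*)
import Data.Rational.Unnormalised.Properties as ℚᵘ
import Data.Vec.Base as Vec
open import Function.Base using (_∘_; id)
open import Relation.Binary.PropositionalEquality as ≡ using (_≡_)
import Relation.Binary.Reasoning.Setoid as SetoidReasoning
open import Relation.Nullary.Negation using (¬_; contradiction)

-- The Euler series is a quotient of power series over K[x], and K[x] is given only as coefficient
-- lists, without ring laws. It is therefore not manipulated there: evaluation at a point is a
-- homomorphism from K[x] to K, it is applied coefficientwise, and the algebra takes place in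
-- K[[t]], for a commutative ring K with a ring homomorphism from ℚ. The arguments w₂w₃t, w₃w₁t and
-- w₁w₂t come from the weights: w₁^(l+m) w₂^(k+m) w₃^(k+l) = (w₂w₃)^k (w₃w₁)^l (w₁w₂)^m. Replacing t
-- by ct is a ring endomorphism of K[[t]], so the identity for each of the three factors can be
-- rescaled separately. Every identity is stated with its denominators multiplied out. They are
-- cancelled only at the end, which is possible because e^{at} + 1 has constant term 2 and ½ comes
-- from ℚ. Of the two equal factors e^{dw₁w₂w₃t} + 1 in the numerator, each power sum contributes
-- one; the Euler factor contributes the exponential in y.

odd⇒≡1+2* : ∀ n → ¬ 2 ∣ℕ n → ∃ λ k → n ≡ suc (k *ℕ 2)
odd⇒≡1+2* zero          ¬2∣n = contradiction (divides 0 ≡.refl) ¬2∣n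
odd⇒≡1+2* (suc zero)    ¬2∣n = 0 , ≡.refl
odd⇒≡1+2* (suc (suc n)) ¬2∣n
  with k , eq ← odd⇒≡1+2* n (¬2∣n ∘ ∣m∣n⇒∣m+n (∣-refl {2})) = suc k , ≡.cong (2 +ℕ_) eq

nCk*k![n∸k]!≡n! : ∀ {n k} → k ≤ n → (n choose k) *ℕ (k ! *ℕ (n ∸ k) !) ≡ n !
nCk*k![n∸k]!≡n! {n} {k} k≤n =
  ≡.trans (≡.cong (_*ℕ (k ! *ℕ (n ∸ k) !)) (nCk≡n!/k![n-k]! k≤n))
          (m/n*n≡m (k![n∸k]!∣n! k≤n))
  where instance
    _ = ℕ.m*n≢0 (k !) ((n ∸ k) !) {{k ℕ.!≢0}} {{(n ∸ k) ℕ.!≢0}}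

-- Fractions in ℚ

module _ where
  open SetoidReasoning ℚᵘ.≃-setoid

  -- `ℚ./` cancels a gcd and so does not compute on variables. The unnormalised fraction keeps
  -- numerator and denominator as given, which turns the two identities below into identities of
  -- integers.
  toℚᵘ-/ : ∀ i n .{{_ : NonZero n}} → toℚᵘ (i ℚ./ n) ℚᵘ.≃ (i ℚᵘ./ n)
  toℚᵘ-/ i (suc n) = ℚ.toℚᵘ-fromℚᵘ (mkℚᵘ i n)

  i/n*n≡i : ∀ i n .{{_ : NonZero n}} → (i ℚ./ n) ℚ.* (+ n ℚ./ 1) ≡ i ℚ./ 1
  i/n*n≡i i n@(suc _) = ℚ.toℚᵘ-injective (begin
    toℚᵘ ((i ℚ./ n) ℚ.* (+ n ℚ./ 1))       ≈⟨ ℚ.toℚᵘ-homo-* (i ℚ./ n) (+ n ℚ./ 1) ⟩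
    toℚᵘ (i ℚ./ n) ℚᵘ.* toℚᵘ (+ n ℚ./ 1)   ≈⟨ ℚᵘ.*-cong (toℚᵘ-/ i n) (toℚᵘ-/ (+ n) 1) ⟩
    (i ℚᵘ./ n) ℚᵘ.* (+ n ℚᵘ./ 1)           ≈⟨ *≡* (≡.trans (ℤ.*-identityʳ (i ℤ.* + n)) (≡.cong (λ m → i ℤ.* + m) (≡.sym (ℕ.*-identityʳ n)))) ⟩
    i ℚᵘ./ 1                               ≈⟨ toℚᵘ-/ i 1 ⟨
    toℚᵘ (i ℚ./ 1)                         ∎)

  1+n/1≡1+[n/1] : ∀ n → + suc n ℚ./ 1 ≡ ℚ.1ℚ ℚ.+ (+ n ℚ./ 1)
  1+n/1≡1+[n/1] n = ℚ.toℚᵘ-injective (begin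
    toℚᵘ (+ suc n ℚ./ 1)                ≈⟨ toℚᵘ-/ (+ suc n) 1 ⟩
    + suc n ℚᵘ./ 1                      ≈⟨ *≡* (≡.cong (ℤ._* 1ℤ) (≡.sym (≡.cong (λ i → 1ℤ ℤ.+ i) (ℤ.*-identityʳ (+ n))))) ⟩
    ℚᵘ.1ℚᵘ ℚᵘ.+ (+ n ℚᵘ./ 1)            ≈⟨ ℚᵘ.+-congʳ ℚᵘ.1ℚᵘ (toℚᵘ-/ (+ n) 1) ⟨
    ℚᵘ.1ℚᵘ ℚᵘ.+ toℚᵘ (+ n ℚ./ 1)        ≈⟨ ℚ.toℚᵘ-homo-+ ℚ.1ℚ (+ n ℚ./ 1) ⟨
    toℚᵘ (ℚ.1ℚ ℚ.+ (+ n ℚ./ 1))         ∎)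

-- Homomorphisms from a raw ring to a commutative ring

module Homomorphism {a ℓa b ℓb} (A : RawRing a ℓa) (B : CommutativeRing b ℓb)
  (φ : RawRing.Carrier A → CommutativeRing.Carrier B)
  (φ-hom : IsRingHomomorphism A (CommutativeRing.rawRing B) φ) where
  private module A where
    open RawRing A public
    open RawSemiringDefs rawSemiring public
  open CommutativeRing B
  open RawRing rawRing using (rawSemiring)
  open RawSemiringDefs rawSemiring using (_^_; sum)
  open IsRingHomomorphism φ-hom

  sum-homo : ∀ {n} (f : Fin n → A.Carrier) → φ (A.sum f) ≈ sum (φ ∘ f)
  sum-homo {zero}  f = 0#-homo
  sum-homo {suc n} f = trans (+-homo _ _) (+-congˡ (sum-homo (f ∘ suc)))

  ^-homo : ∀ x n → φ (x A.^ n) ≈ φ x ^ n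
  ^-homo x zero    = 1#-homo
  ^-homo x (suc n) = trans (*-homo _ _) (*-congˡ (^-homo x n))

  fromℕ-homo : ∀ n → φ (fromℕ A n) ≈ fromℕ rawRing n
  fromℕ-homo zero    = 0#-homo
  fromℕ-homo (suc n) = trans (+-homo _ _) (+-cong 1#-homo (fromℕ-homo n))

module _ {a ℓa b ℓb} (A : RawRing a ℓa) (B : RawRing b ℓb)
  (φ : RawRing.Carrier A → RawRing.Carrier B) where
  private
    module A = RawRing A
    module B = RawRing B

  isRingHomomorphism :
    (∀ {x y} → x A.≈ y → φ x B.≈ φ y) →
    (∀ x y → φ (x A.+ y) B.≈ φ x B.+ φ y) →
    (∀ x y → φ (x A.* y) B.≈ φ x B.* φ y) →
    (∀ x → φ (A.- x) B.≈ B.- φ x) →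
    φ A.0# B.≈ B.0# → φ A.1# B.≈ B.1# → IsRingHomomorphism A B φ
  isRingHomomorphism cong +-homo *-homo -‿homo 0#-homo 1#-homo = record
    { isSemiringHomomorphism = record
      { isNearSemiringHomomorphism = record
        { +-isMonoidHomomorphism = record
          { isMagmaHomomorphism = record
            { isRelHomomorphism = record { cong = cong }
            ; homo              = +-homo
            }
          ; ε-homo = 0#-homo
          }
        ; *-homo = *-homo
        }
      ; 1#-homo = 1#-homo
      }
    ; -‿homo = -‿homo
    }

-- Finite sums, odd powers and geometric sums in a commutative ring

module CommutativeRingLemmas {c ℓ} (K : CommutativeRing c ℓ) where
  open CommutativeRing K public
  open RawRing rawRing public using (rawSemiring)
  open RawSemiringDefs rawSemiring public using (_^_; sum) renaming (_×_ to _·_)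
  open Sum semiring public using (sum-cong-≋; *-distribˡ-sum)
  open CommutativeMonoidSum +-commutativeMonoid public using (∑-distrib-+)
  open Exp semiring public using (^-homo-*; ^-congˡ)
  open CommutativeExp commutativeSemiring public using (^-distrib-*)
  open Mult semiring public using (×-congʳ; ×1-homo-*; ×-homo-+; ×-assoc-*)
  open RingProperties ring public
  module ≈-Reasoning = SetoidReasoning setoid
  open Solver commutativeSemiring public using (solve; _:=_; _:*_; _:+_; con)

  ∑ : ℕ → (ℕ → Carrier) → Carrier
  ∑ = ∑[_] rawRing

  ∑-cong : ∀ n {f g : ℕ → Carrier} → (∀ i → f i ≈ g i) → ∑ n f ≈ ∑ n g
  ∑-cong n f≈g = sum-cong-≋ {n} (f≈g ∘ toℕ)

  ∑-cong-≤ : ∀ n {f g : ℕ → Carrier} → (∀ i → i ≤ n → f i ≈ g i) → ∑ (suc n) f ≈ ∑ (suc n) g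
  ∑-cong-≤ n f≈g = sum-cong-≋ {suc n} λ i → f≈g (toℕ i) (toℕ≤pred[n] i)

  ∑-+ : ∀ m n (f : ℕ → Carrier) → ∑ (m +ℕ n) f ≈ ∑ m f + ∑ n (λ i → f (m +ℕ i))
  ∑-+ zero    n f = sym (+-identityˡ _)
  ∑-+ (suc m) n f = trans (+-congˡ (∑-+ m n (f ∘ suc))) (sym (+-assoc _ _ _))

  ∑-zero : ∀ n {f : ℕ → Carrier} → (∀ i → f i ≈ 0#) → ∑ n f ≈ 0#
  ∑-zero zero    f≈0 = refl
  ∑-zero (suc n) f≈0 = trans (+-cong (f≈0 0) (∑-zero n (f≈0 ∘ suc))) (+-identityˡ 0#)

  -x*-y≈x*y : ∀ x y → - x * - y ≈ x * y
  -x*-y≈x*y x y = trans (sym (-‿distribˡ-* x (- y)))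
    (trans (-‿cong (sym (-‿distribʳ-* x y))) (-‿involutive (x * y)))

  [-x]^odd : ∀ n → ¬ 2 ∣ℕ n → ∀ x → (- x) ^ n ≈ - (x ^ n)
  [-x]^odd n ¬2∣n x with k , ≡.refl ← odd⇒≡1+2* n ¬2∣n = go k
    where
    open ≈-Reasoning
    go : ∀ k → (- x) ^ suc (k *ℕ 2) ≈ - (x ^ suc (k *ℕ 2))
    go zero    = sym (-‿distribˡ-* x 1#)
    go (suc k) = begin
      - x * (- x * (- x) ^ suc (k *ℕ 2))     ≈⟨ *-assoc _ _ _ ⟨
      - x * - x * (- x) ^ suc (k *ℕ 2)       ≈⟨ *-cong (-x*-y≈x*y x x) (go k) ⟩
      x * x * - (x ^ suc (k *ℕ 2))           ≈⟨ -‿distribʳ-* _ _ ⟨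
      - (x * x * x ^ suc (k *ℕ 2))           ≈⟨ -‿cong (*-assoc _ _ _) ⟩
      - (x * (x * x ^ suc (k *ℕ 2)))         ∎

  1^n≈1 : ∀ n → 1# ^ n ≈ 1#
  1^n≈1 zero    = refl
  1^n≈1 (suc n) = trans (*-identityˡ _) (1^n≈1 n)

  x*y≈1⇒*-cancelˡ : ∀ {x y} → x * y ≈ 1# → ∀ {a b} → x * a ≈ x * b → a ≈ b
  x*y≈1⇒*-cancelˡ {x} {y} xy≈1 {a} {b} xa≈xb = begin
    a              ≈⟨ *-identityˡ a ⟨
    1# * a         ≈⟨ *-congʳ xy≈1 ⟨
    x * y * a      ≈⟨ solve 3 (λ x y a → (x :* y) :* a := y :* (x :* a)) refl x y a ⟩
    y * (x * a)    ≈⟨ *-congˡ xa≈xb ⟩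
    y * (x * b)    ≈⟨ solve 3 (λ x y a → y :* (x :* a) := (x :* y) :* a) refl x y b ⟩
    x * y * b      ≈⟨ *-congʳ xy≈1 ⟩
    1# * b         ≈⟨ *-identityˡ b ⟩
    b              ∎
    where open ≈-Reasoning

  -- Removing the first block of d terms leaves, by `shift`, r times the sum with one block fewer.
  -- Multiplying by `1# - r` makes the closed form meaningful without an inverse of `1# - r`.
  geometric-∑ : ∀ d r (f : ℕ → Carrier) → (∀ a → f (d +ℕ a) ≈ r * f a) →
                ∀ w → ∑ (w *ℕ d) f * (1# - r) ≈ ∑ d f * (1# - r ^ w)
  geometric-∑ d r f shift zero = begin
    0# * (1# - r)         ≈⟨ zeroˡ _ ⟩
    0#                    ≈⟨ zeroʳ _ ⟨
    ∑ d f * 0#            ≈⟨ *-congˡ (-‿inverseʳ 1#) ⟨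
    ∑ d f * (1# - 1#)     ∎
    where open ≈-Reasoning
  geometric-∑ d r f shift (suc w) = begin
    ∑ (d +ℕ w *ℕ d) f * (1# - r)
      ≈⟨ *-congʳ (∑-+ d (w *ℕ d) f) ⟩
    (∑ d f + ∑ (w *ℕ d) (λ a → f (d +ℕ a))) * (1# - r)
      ≈⟨ *-congʳ (+-congˡ (trans (∑-cong (w *ℕ d) shift) (sym (*-distribˡ-sum {w *ℕ d} r (f ∘ toℕ))))) ⟩
    (∑ d f + r * ∑ (w *ℕ d) f) * (1# - r)
      ≈⟨ distribʳ _ _ _ ⟩
    ∑ d f * (1# - r) + r * ∑ (w *ℕ d) f * (1# - r)
      ≈⟨ +-congˡ (trans (*-assoc _ _ _) (*-congˡ (geometric-∑ d r f shift w))) ⟩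
    ∑ d f * (1# - r) + r * (∑ d f * (1# - r ^ w))
      -- The solver knows semirings only, so `- r` and `- (r ^ w)` are passed as independent atoms
      -- and `- r + r` is cancelled by hand afterwards.
      ≈⟨ solve 4 (λ s n r m → s :* (con 1 :+ n) :+ r :* (s :* (con 1 :+ m)) := s :* ((con 1 :+ (n :+ r)) :+ r :* m))
           refl (∑ d f) (- r) r (- (r ^ w)) ⟩
    ∑ d f * (1# + (- r + r) + r * - (r ^ w))
      ≈⟨ *-congˡ (+-cong (trans (+-congˡ (-‿inverseˡ r)) (+-identityʳ 1#)) (sym (-‿distribʳ-* r (r ^ w)))) ⟩
    ∑ d f * (1# - r ^ suc w) ∎
    where open ≈-Reasoning

-- The ring K[[t]], substitution of ct for t, and division

module PowerSeries {c ℓ} (K : CommutativeRing c ℓ) where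
  open CommutativeRingLemmas K
  open ≈-Reasoning
  private
    S = Series rawRing
    module S = RawRing (seriesRing rawRing)

    tail : S → S
    tail f = f ∘ suc

  series-*-cong : ∀ {f f′ g g′ : S} → f S.≈ f′ → g S.≈ g′ → (f S.* g) S.≈ (f′ S.* g′)
  series-*-cong f≈f′ g≈g′ n = ∑-cong (suc n) λ i → *-cong (f≈f′ i) (g≈g′ (n ∸ i))

  -- The convolution unfolds only along its first factor: (fg)(n+1) = f(0) g(n+1) + (tail f · g)(n).
  -- Swapping the factors gives access to the other end. After both end terms are split off, tail f
  -- · tail g remains at n, which explains the two base cases and the recursion on n and n + 1.
  series-*-comm : ∀ f g → (f S.* g) S.≈ (g S.* f)
  series-*-comm f g zero          = +-congʳ (*-comm _ _)
  series-*-comm f g (suc zero)    =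
    solve 4 (λ a b c d → a :* b :+ (c :* d :+ con 0) := d :* c :+ (b :* a :+ con 0)) refl _ _ _ _
  series-*-comm f g (suc (suc n)) = begin
    f 0 * g (2 +ℕ n) + (tail f S.* g) (suc n)
      ≈⟨ +-congˡ (series-*-comm (tail f) g (suc n)) ⟩
    f 0 * g (2 +ℕ n) + (g 0 * f (2 +ℕ n) + (tail g S.* tail f) n)
      ≈⟨ +-congˡ (+-congˡ (series-*-comm (tail g) (tail f) n)) ⟩
    f 0 * g (2 +ℕ n) + (g 0 * f (2 +ℕ n) + (tail f S.* tail g) n)
      ≈⟨ solve 3 (λ a b c → a :+ (b :+ c) := b :+ (a :+ c)) refl _ _ _ ⟩
    g 0 * f (2 +ℕ n) + (f 0 * g (2 +ℕ n) + (tail f S.* tail g) n)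
      ≈⟨ +-congˡ (series-*-comm (tail g) f (suc n)) ⟨
    g 0 * f (2 +ℕ n) + (tail g S.* f) (suc n) ∎

  series-distribʳ : ∀ h f g → ((f S.+ g) S.* h) S.≈ ((f S.* h) S.+ (g S.* h))
  series-distribʳ h f g n = trans (∑-cong (suc n) λ i → distribʳ (h (n ∸ i)) (f i) (g i))
    (∑-distrib-+ {suc n} (λ i → f (toℕ i) * h (n ∸ toℕ i)) (λ i → g (toℕ i) * h (n ∸ toℕ i)))

  scalar-* : ∀ a f g n → ((λ i → a * f i) S.* g) n ≈ a * (f S.* g) n
  scalar-* a f g n = trans (∑-cong (suc n) λ i → *-assoc a (f i) (g (n ∸ i)))
    (sym (*-distribˡ-sum {suc n} a λ i → f (toℕ i) * g (n ∸ toℕ i)))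

  constSeries-* : ∀ a f n → (constSeries rawRing a S.* f) n ≈ a * f n
  constSeries-* a f n = trans (+-congˡ (∑-zero n λ i → zeroˡ (f (n ∸ suc i)))) (+-identityʳ _)

  -- By definition tail (fg) = f(0) · tail g + tail f · g, so the induction runs on the index with f
  -- replaced by its tail.
  series-*-assoc : ∀ f g h → ((f S.* g) S.* h) S.≈ (f S.* (g S.* h))
  series-*-assoc f g h zero =
    solve 3 (λ a b c → (a :* b :+ con 0) :* c :+ con 0 := a :* (b :* c :+ con 0) :+ con 0) refl _ _ _
  series-*-assoc f g h (suc n) = begin
    (f S.* g) 0 * h (suc n) + (((λ i → f 0 * g (suc i)) S.+ (tail f S.* g)) S.* h) n
      ≈⟨ +-congˡ (series-distribʳ h (λ i → f 0 * g (suc i)) (tail f S.* g) n) ⟩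
    (f S.* g) 0 * h (suc n) + (((λ i → f 0 * g (suc i)) S.* h) n + ((tail f S.* g) S.* h) n)
      ≈⟨ +-congˡ (+-cong (scalar-* (f 0) (tail g) h n) (series-*-assoc (tail f) g h n)) ⟩
    (f 0 * g 0 + 0#) * h (suc n) + (f 0 * (tail g S.* h) n + (tail f S.* (g S.* h)) n)
      ≈⟨ solve 5 (λ a b c d e → (a :* b :+ con 0) :* c :+ (a :* d :+ e) := a :* (b :* c :+ d) :+ e) refl _ _ _ _ _ ⟩
    f 0 * (g S.* h) (suc n) + (tail f S.* (g S.* h)) n ∎

  seriesCommutativeRing : CommutativeRing c ℓ
  seriesCommutativeRing = record
    { Carrier = S ; _≈_ = S._≈_ ; _+_ = S._+_ ; _*_ = S._*_ ; -_ = S.-_ ; 0# = S.0# ; 1# = S.1#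
    ; isCommutativeRing = record
      { isRing = record
        { +-isAbelianGroup = record
          { isGroup = record
            { isMonoid = record
              { isSemigroup = record
                { isMagma = record
                  { isEquivalence = record
                    { refl  = λ n → refl
                    ; sym   = λ f≈g n → sym (f≈g n)
                    ; trans = λ f≈g g≈h n → trans (f≈g n) (g≈h n)
                    }
                  ; ∙-cong = λ f≈f′ g≈g′ n → +-cong (f≈f′ n) (g≈g′ n)
                  }
                ; assoc = λ f g h n → +-assoc (f n) (g n) (h n)
                }
              ; identity = (λ f n → +-identityˡ (f n)) , (λ f n → +-identityʳ (f n))
              }
            ; inverse = (λ f n → -‿inverseˡ (f n)) , (λ f n → -‿inverseʳ (f n))
            ; ⁻¹-cong = λ f≈g n → -‿cong (f≈g n)
            }
          ; comm = λ f g n → +-comm (f n) (g n)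
          }
        ; *-cong = series-*-cong
        ; *-assoc = series-*-assoc
        ; *-identity = identityˡ , λ f n → trans (series-*-comm f S.1# n) (identityˡ f n)
        ; distrib = (λ h f g n → begin
            (h S.* (f S.+ g)) n             ≈⟨ series-*-comm h (f S.+ g) n ⟩
            ((f S.+ g) S.* h) n             ≈⟨ series-distribʳ h f g n ⟩
            (f S.* h) n + (g S.* h) n       ≈⟨ +-cong (series-*-comm f h n) (series-*-comm g h n) ⟩
            (h S.* f) n + (h S.* g) n       ∎)
          , series-distribʳ
        }
      ; *-comm = series-*-comm
      }
    }
    where
    identityˡ : ∀ f → (S.1# S.* f) S.≈ f
    identityˡ f n = trans (constSeries-* 1# f n) (*-identityˡ (f n))

  ∑-pointwise : ∀ m (f : ℕ → S) n → ∑[_] (seriesRing rawRing) m f n ≈ ∑ m (λ a → f a n)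
  ∑-pointwise zero    f n = refl
  ∑-pointwise (suc m) f n = +-congˡ (∑-pointwise m (f ∘ suc) n)

  constSeries-isRingHomomorphism :
    IsRingHomomorphism rawRing (seriesRing rawRing) (constSeries rawRing)
  constSeries-isRingHomomorphism = isRingHomomorphism _ _ _
    (λ { x≈y zero → x≈y ; _ (suc n) → refl })
    (λ { _ _ zero → refl ; _ _ (suc n) → sym (+-identityˡ 0#) })
    (λ { x y zero → sym (constSeries-* x (constSeries rawRing y) 0)
       ; x y (suc n) → sym (trans (constSeries-* x (constSeries rawRing y) (suc n)) (zeroʳ x)) })
    (λ { _ zero → refl ; _ (suc n) → sym -0#≈0# })
    (λ { zero → refl ; (suc n) → refl })
    (λ n → refl)

  -- The substitution of ct for t.
  scale : Carrier → S → S
  scale c f n = c ^ n * f n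

  scale-isRingHomomorphism : ∀ c →
    IsRingHomomorphism (seriesRing rawRing) (seriesRing rawRing) (scale c)
  scale-isRingHomomorphism c = isRingHomomorphism _ _ _
    (λ f≈g n → *-congˡ (f≈g n))
    (λ f g n → distribˡ _ _ _)
    *-homo
    (λ f n → sym (-‿distribʳ-* _ _))
    (λ n → zeroʳ _)
    (λ { zero → *-identityˡ 1# ; (suc n) → zeroʳ _ })
    where
    *-homo : ∀ f g → scale c (f S.* g) S.≈ (scale c f S.* scale c g)
    *-homo f g n = begin
      c ^ n * ∑ (suc n) (λ i → f i * g (n ∸ i))
        ≈⟨ *-distribˡ-sum {suc n} (c ^ n) (λ i → f (toℕ i) * g (n ∸ toℕ i)) ⟩
      ∑ (suc n) (λ i → c ^ n * (f i * g (n ∸ i)))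
        ≈⟨ ∑-cong-≤ n (λ i i≤n → trans
             (*-congʳ (trans (reflexive (≡.cong (c ^_) (≡.sym (ℕ.m+[n∸m]≡n i≤n)))) (^-homo-* c i (n ∸ i))))
             (solve 4 (λ x y z w → (x :* y) :* (z :* w) := (x :* z) :* (y :* w)) refl (c ^ i) (c ^ (n ∸ i)) (f i) (g (n ∸ i)))) ⟩
      ∑ (suc n) (λ i → c ^ i * f i * (c ^ (n ∸ i) * g (n ∸ i))) ∎

  module _ {a ℓa} (A : RawRing a ℓa) (φ : RawRing.Carrier A → Carrier)
    (φ-hom : IsRingHomomorphism A rawRing φ) where
    open IsRingHomomorphism φ-hom
    open Homomorphism A K φ φ-hom
    private module A where
      open RawRing A public
      open RawSemiringDefs (RawRing.rawSemiring A) public using (sum)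

    mapSeries-isRingHomomorphism :
      IsRingHomomorphism (seriesRing A) (seriesRing rawRing) (φ ∘_)
    mapSeries-isRingHomomorphism = isRingHomomorphism _ _ _
      (λ f≈g n → ⟦⟧-cong (f≈g n))
      (λ f g n → +-homo _ _)
      (λ f g n → trans (sum-homo {suc n} λ i → f (toℕ i) A.* g (n ∸ toℕ i))
        (sum-cong-≋ {suc n} λ i → *-homo (f (toℕ i)) (g (n ∸ toℕ i))))
      (λ f n → -‿homo _)
      (λ n → 0#-homo)
      (λ { zero → 1#-homo ; (suc n) → 0#-homo })

    -- Read through φ because K[x], where the quotient lives, is only a raw ring here.
    *-divide : ∀ u f g → φ (g 0) * φ u ≈ 1# →
               ((φ ∘ g) S.* (φ ∘ divide A u f g)) S.≈ (φ ∘ f)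
    *-divide u f g gu≈1 n = begin
      φ (g 0) * φ (u A.* (f n A.+ A.- s)) + ∑ n (λ i → φ (g (suc i)) * φ (divide A u f g (n ∸ suc i)))
        ≈⟨ +-cong (*-congˡ (trans (*-homo _ _) (*-congˡ (trans (+-homo _ _) (+-congˡ (-‿homo s)))))) rest ⟩
      φ (g 0) * (φ u * (φ (f n) + - φ s)) + φ s
        ≈⟨ +-congʳ (trans (sym (*-assoc _ _ _)) (trans (*-congʳ gu≈1) (*-identityˡ _))) ⟩
      φ (f n) + - φ s + φ s
        ≈⟨ trans (+-assoc _ _ _) (trans (+-congˡ (-‿inverseˡ _)) (+-identityʳ _)) ⟩
      φ (f n) ∎
      where
      q = quotientCoeffs A u f g

      -- The vector runs downwards from index n - 1, so entry i is the coefficient that the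
      -- convolution pairs with g(i + 1).
      lookup-q : ∀ n (i : Fin n) → Vec.lookup (q n) i ≡ divide A u f g (n ∸ suc (toℕ i))
      lookup-q (suc n) zero    = ≡.refl
      lookup-q (suc n) (suc i) = lookup-q n i

      s = A.sum (λ i → g (suc (toℕ i)) A.* Vec.lookup (q n) i)

      rest : ∑ n (λ i → φ (g (suc i)) * φ (divide A u f g (n ∸ suc i))) ≈ φ s
      rest = sym (trans (sum-homo {n} _) (sum-cong-≋ {n} λ i → trans (*-homo _ _)
        (*-congˡ (reflexive (≡.cong φ (lookup-q n i))))))

  invertible : ∀ u g → g 0 * u ≈ 1# → ∃ λ h → (g S.* h) S.≈ S.1#
  invertible u g gu≈1 = _ ,
    -- The inverse is the quotient of 1 by g; with φ the identity, the division lemma says precisely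
    -- that it is an inverse.
    *-divide rawRing id (Identity.isRingHomomorphism rawRing refl) u S.1# g gu≈1

-- Evaluation of coefficient lists at a point

module Evaluation {c ℓ} (K : CommutativeRing c ℓ) (x : CommutativeRing.Carrier K) where
  open CommutativeRingLemmas K
  open ≈-Reasoning

  ev : Poly rawRing → Carrier
  ev f = eval rawRing f x

  -- Equal polynomials may be lists of different lengths. This disposes of the surplus zeros when
  -- one list ends before the other.
  ev-≈0 : ∀ f → (∀ n → coeff rawRing f n ≈ 0#) → ev f ≈ 0#
  ev-≈0 []      f≈0 = refl
  ev-≈0 (a ∷ f) f≈0 = trans (+-cong (f≈0 0) (trans (*-congˡ (ev-≈0 f (f≈0 ∘ suc))) (zeroʳ x))) (+-identityˡ 0#)

  ev-cong : ∀ f g → (∀ n → coeff rawRing f n ≈ coeff rawRing g n) → ev f ≈ ev g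
  ev-cong []      g       f≈g = sym (ev-≈0 g (λ n → sym (f≈g n)))
  ev-cong (a ∷ f) []      f≈g = ev-≈0 (a ∷ f) f≈g
  ev-cong (a ∷ f) (b ∷ g) f≈g = +-cong (f≈g 0) (*-congˡ (ev-cong f g (f≈g ∘ suc)))

  ev-+ : ∀ f g → ev (addPoly rawRing f g) ≈ ev f + ev g
  ev-+ []      g       = sym (+-identityˡ _)
  ev-+ (a ∷ f) []      = sym (+-identityʳ _)
  ev-+ (a ∷ f) (b ∷ g) = trans (+-congˡ (*-congˡ (ev-+ f g)))
    (solve 5 (λ a b x f g → (a :+ b) :+ x :* (f :+ g) := (a :+ x :* f) :+ (b :+ x :* g)) refl a b x (ev f) (ev g))

  ev-scalar : ∀ a f → ev (List.map (a *_) f) ≈ a * ev f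
  ev-scalar a []      = sym (zeroʳ a)
  ev-scalar a (b ∷ f) = trans (+-congˡ (*-congˡ (ev-scalar a f)))
    (solve 4 (λ a b x f → a :* b :+ x :* (a :* f) := a :* (b :+ x :* f)) refl a b x (ev f))

  ev-* : ∀ f g → ev (mulPoly rawRing f g) ≈ ev f * ev g
  ev-* []      g = sym (zeroˡ _)
  ev-* (a ∷ f) g = begin
    ev (addPoly rawRing (List.map (a *_) g) (0# ∷ mulPoly rawRing f g))
      ≈⟨ ev-+ (List.map (a *_) g) (0# ∷ mulPoly rawRing f g) ⟩
    ev (List.map (a *_) g) + (0# + x * ev (mulPoly rawRing f g))
      ≈⟨ +-cong (ev-scalar a g) (+-congˡ (*-congˡ (ev-* f g))) ⟩
    a * ev g + (0# + x * (ev f * ev g))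
      ≈⟨ solve 4 (λ a x f g → a :* g :+ (con 0 :+ x :* (f :* g)) := (a :+ x :* f) :* g) refl a x (ev f) (ev g) ⟩
    (a + x * ev f) * ev g ∎

  ev-neg : ∀ f → ev (List.map (-_) f) ≈ - ev f
  ev-neg []      = sym -0#≈0#
  ev-neg (a ∷ f) = begin
    - a + x * ev (List.map (-_) f)  ≈⟨ +-congˡ (trans (*-congˡ (ev-neg f)) (sym (-‿distribʳ-* x (ev f)))) ⟩
    - a + - (x * ev f)              ≈⟨ -‿+-comm a (x * ev f) ⟩
    - (a + x * ev f)                ∎

  ev-const : ∀ a → ev (constPoly rawRing a) ≈ a
  ev-const a = trans (+-congˡ (zeroʳ x)) (+-identityʳ a)

  ev-X : ev (X rawRing) ≈ x
  ev-X = trans (+-identityˡ _) (trans (*-congˡ (ev-const 1#)) (*-identityʳ x))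

  ev-isRingHomomorphism : IsRingHomomorphism (polyRing rawRing) rawRing ev
  ev-isRingHomomorphism =
    isRingHomomorphism _ _ _ (λ {f} {g} → ev-cong f g) ev-+ ev-* ev-neg refl (ev-const 1#)

-- Inverse factorials and exponential series over a ℚ-algebra

module Exponential {c ℓ} (K : CommutativeRing c ℓ) (ι : ℚ → CommutativeRing.Carrier K)
  (ι-hom : IsRingHomomorphism (Defs.rawRing ℚ.heytingField) (CommutativeRing.rawRing K) ι) where
  open CommutativeRingLemmas K
  open PowerSeries K
  open ≈-Reasoning
  private
    module ι = IsRingHomomorphism ι-hom
    module S = CommutativeRingLemmas seriesCommutativeRing

  fromℕ′ : ℕ → Carrier
  fromℕ′ = fromℕ rawRing

  e^_ : Carrier → S.Carrier
  e^_ = exp rawRing ι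

  infix 9 e^_

  _!⁻¹ : ℕ → Carrier
  n !⁻¹ = ι ((1ℤ ℚ./ n !) {{n ℕ.!≢0}})

  ι-fromℕ : ∀ n → ι (+ n ℚ./ 1) ≈ fromℕ′ n
  ι-fromℕ zero    = ι.0#-homo
  ι-fromℕ (suc n) = trans (reflexive (≡.cong ι (1+n/1≡1+[n/1] n)))
    (trans (ι.+-homo _ _) (+-cong ι.1#-homo (ι-fromℕ n)))

  ι-/ : ∀ m n .{{_ : NonZero n}} → ι (+ m ℚ./ n) * fromℕ′ n ≈ fromℕ′ m
  ι-/ m n = begin
    ι (+ m ℚ./ n) * fromℕ′ n             ≈⟨ *-congˡ (ι-fromℕ n) ⟨
    ι (+ m ℚ./ n) * ι (+ n ℚ./ 1)        ≈⟨ ι.*-homo _ _ ⟨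
    ι ((+ m ℚ./ n) ℚ.* (+ n ℚ./ 1))      ≡⟨ ≡.cong ι (i/n*n≡i (+ m) n) ⟩
    ι (+ m ℚ./ 1)                        ≈⟨ ι-fromℕ m ⟩
    fromℕ′ m                             ∎

  n!⁻¹*n!≈1 : ∀ n → n !⁻¹ * fromℕ′ (n !) ≈ 1#
  n!⁻¹*n!≈1 n = trans (ι-/ 1 (n !) {{n ℕ.!≢0}}) (+-identityʳ 1#)

  -- Inserting 1 = (k!⁻¹ k!)((n-k)!⁻¹ (n-k)!) reduces the claim to the identity of natural numbers
  -- C(n,k) k! (n-k)! = n!.
  n!⁻¹*nCk : ∀ {n k} → k ≤ n → n !⁻¹ * fromℕ′ (n choose k) ≈ k !⁻¹ * (n ∸ k) !⁻¹
  n!⁻¹*nCk {n} {k} k≤n = begin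
    n !⁻¹ * c′
      ≈⟨ trans (sym (*-identityʳ _)) (*-congˡ (sym (trans (*-cong (n!⁻¹*n!≈1 k) (n!⁻¹*n!≈1 j)) (*-identityˡ 1#)))) ⟩
    n !⁻¹ * c′ * (k !⁻¹ * fromℕ′ (k !) * (j !⁻¹ * fromℕ′ (j !)))
      ≈⟨ solve 6 (λ n c k k′ j j′ → (n :* c) :* ((k :* k′) :* (j :* j′)) := (n :* (c :* (k′ :* j′))) :* (k :* j))
           refl (n !⁻¹) c′ (k !⁻¹) (fromℕ′ (k !)) (j !⁻¹) (fromℕ′ (j !)) ⟩
    n !⁻¹ * (c′ * (fromℕ′ (k !) * fromℕ′ (j !))) * (k !⁻¹ * j !⁻¹)
      ≈⟨ *-congʳ (*-congˡ (trans (*-congˡ (sym (×1-homo-* (k !) (j !)))) (sym (×1-homo-* (n choose k) (k ! *ℕ j !))))) ⟩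
    n !⁻¹ * fromℕ′ ((n choose k) *ℕ (k ! *ℕ j !)) * (k !⁻¹ * j !⁻¹)
      ≈⟨ *-congʳ (*-congˡ (reflexive (≡.cong fromℕ′ (nCk*k![n∸k]!≡n! k≤n)))) ⟩
    n !⁻¹ * fromℕ′ (n !) * (k !⁻¹ * j !⁻¹)
      ≈⟨ trans (*-congʳ (n!⁻¹*n!≈1 n)) (*-identityˡ _) ⟩
    k !⁻¹ * j !⁻¹ ∎
    where
    j = n ∸ k
    c′ = fromℕ′ (n choose k)

  -- The three indices are treated unequally to match the factors: the Euler polynomial is k! times
  -- a series coefficient, so k! stands beside the multinomial, whereas the two power sums still
  -- need 1/l! and 1/m! to become series coefficients.
  multinomial-*-k! : ∀ n k l m →
    ι (multinomial n k l m) * fromℕ′ (k !) ≈ fromℕ′ (n !) * (l !⁻¹ * m !⁻¹)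
  multinomial-*-k! n k l m = begin
    M * k′
      ≈⟨ trans (sym (*-identityʳ _)) (*-congˡ (sym (trans (*-cong (n!⁻¹*n!≈1 l) (n!⁻¹*n!≈1 m)) (*-identityˡ 1#)))) ⟩
    M * k′ * (l !⁻¹ * l′ * (m !⁻¹ * m′))
      ≈⟨ solve 6 (λ M k l l′ m m′ → (M :* k) :* ((l :* l′) :* (m :* m′)) := (M :* ((k :* l′) :* m′)) :* (l :* m))
           refl M k′ (l !⁻¹) l′ (m !⁻¹) m′ ⟩
    M * (k′ * l′ * m′) * (l !⁻¹ * m !⁻¹)
      ≈⟨ *-congʳ (*-congˡ (trans (*-congʳ (sym (×1-homo-* (k !) (l !)))) (sym (×1-homo-* (k ! *ℕ l !) (m !))))) ⟩
    M * fromℕ′ (k ! *ℕ l ! *ℕ m !) * (l !⁻¹ * m !⁻¹)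
      ≈⟨ *-congʳ (ι-/ (n !) (k ! *ℕ l ! *ℕ m !)) ⟩
    fromℕ′ (n !) * (l !⁻¹ * m !⁻¹) ∎
    where
    instance
      _ = k ℕ.!≢0
      _ = l ℕ.!≢0
      _ = m ℕ.!≢0
      _ = ℕ.m*n≢0 (k !) (l !)
      _ = ℕ.m*n≢0 (k ! *ℕ l !) (m !)
    M = ι (multinomial n k l m)
    k′ = fromℕ′ (k !)
    l′ = fromℕ′ (l !)
    m′ = fromℕ′ (m !)

  e^-cong : ∀ {a b} → a ≈ b → e^ a S.≈ e^ b
  e^-cong a≈b n = *-congˡ (^-congˡ n a≈b)

  e^0≈1 : e^ 0# S.≈ S.1#
  e^0≈1 zero    = trans (*-identityʳ _) ι.1#-homo
  e^0≈1 (suc n) = trans (*-congˡ (zeroˡ _)) (zeroʳ _)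

  e^[a+b]≈e^a*e^b : ∀ a b → e^ (a + b) S.≈ e^ a S.* e^ b
  e^[a+b]≈e^a*e^b a b n = begin
    n !⁻¹ * (a + b) ^ n
      ≈⟨ *-congˡ (Binomial.theorem commutativeSemiring n a b) ⟩
    n !⁻¹ * ∑ (suc n) (λ k → (n choose k) · (a ^ k * b ^ (n ∸ k)))
      ≈⟨ *-distribˡ-sum {suc n} (n !⁻¹) (λ k → (n choose toℕ k) · (a ^ toℕ k * b ^ (n ∸ toℕ k))) ⟩
    ∑ (suc n) (λ k → n !⁻¹ * (n choose k) · (a ^ k * b ^ (n ∸ k)))
      ≈⟨ ∑-cong-≤ n (λ k k≤n → begin
           n !⁻¹ * (n choose k) · (a ^ k * b ^ (n ∸ k))
             ≈⟨ *-congˡ (trans (×-congʳ (n choose k) (sym (*-identityˡ _))) (sym (×-assoc-* (n choose k) _ _))) ⟩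
           n !⁻¹ * (fromℕ′ (n choose k) * (a ^ k * b ^ (n ∸ k)))
             ≈⟨ *-assoc _ _ _ ⟨
           n !⁻¹ * fromℕ′ (n choose k) * (a ^ k * b ^ (n ∸ k))
             ≈⟨ *-congʳ (n!⁻¹*nCk k≤n) ⟩
           k !⁻¹ * (n ∸ k) !⁻¹ * (a ^ k * b ^ (n ∸ k))
             ≈⟨ solve 4 (λ p q r s → (p :* q) :* (r :* s) := (p :* r) :* (q :* s)) refl (k !⁻¹) ((n ∸ k) !⁻¹) (a ^ k) (b ^ (n ∸ k)) ⟩
           k !⁻¹ * a ^ k * ((n ∸ k) !⁻¹ * b ^ (n ∸ k)) ∎) ⟩
    (e^ a S.* e^ b) n ∎

  e^[n*a]≈[e^a]^n : ∀ a n → e^ (fromℕ′ n * a) S.≈ (e^ a) S.^ n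
  e^[n*a]≈[e^a]^n a zero    = S.trans (e^-cong (zeroˡ a)) e^0≈1
  e^[n*a]≈[e^a]^n a (suc n) = S.trans (e^-cong (trans (distribʳ a 1# _) (+-congʳ (*-identityˡ a))))
    (S.trans (e^[a+b]≈e^a*e^b a _) (S.*-congˡ {e^ a} (e^[n*a]≈[e^a]^n a n)))

  scale-e^ : ∀ c a → scale c (e^ a) S.≈ e^ (c * a)
  scale-e^ c a n = begin
    c ^ n * (n !⁻¹ * a ^ n)    ≈⟨ solve 3 (λ c f a → c :* (f :* a) := f :* (c :* a)) refl (c ^ n) (n !⁻¹) (a ^ n) ⟩
    n !⁻¹ * (c ^ n * a ^ n)    ≈⟨ *-congˡ (^-distrib-* c a n) ⟨
    n !⁻¹ * (c * a) ^ n        ∎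

  ½-inverse : ι ½ * fromℕ′ 2 ≈ 1#
  ½-inverse = trans (ι-/ 1 2) (+-identityʳ 1#)

-- Generating series of the power sums and of the Euler polynomials

module EulerSeries {κ ℓ} (K : CommutativeRing κ ℓ) (ι : ℚ → CommutativeRing.Carrier K)
  (ι-hom : IsRingHomomorphism (Defs.rawRing ℚ.heytingField) (CommutativeRing.rawRing K) ι)
  (d : ℕ) (d-odd : ¬ 2 ∣ℕ d) (χ : ℤ → CommutativeRing.Carrier K)
  (χ-shift : ∀ a → CommutativeRing._≈_ K (χ (+ (d +ℕ a))) (χ (+ a))) where
  open CommutativeRingLemmas K
  open PowerSeries K
  open Exponential K ι ι-hom
  private
    module S = CommutativeRingLemmas seriesCommutativeRing
    module Scale c = Homomorphism (seriesRing rawRing) seriesCommutativeRing (scale c) (scale-isRingHomomorphism c)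
    module scale c = IsRingHomomorphism (scale-isRingHomomorphism c)
    const : Carrier → S.Carrier
    const = constSeries rawRing
    2ˢ : S.Carrier
    2ˢ = fromℕ (seriesRing rawRing) 2

  δ : Carrier
  δ = fromℕ′ d

  term : ℕ → S.Carrier
  term a = (S.- S.1#) S.^ a S.* const (χ (+ a)) S.* e^ (fromℕ′ a)

  -- Z w = ∑_l T_l(w d - 1, χ) t^l / l!.
  Z : ℕ → S.Carrier
  Z w = S.∑ (w *ℕ d) term

  -- The ratio of terms one period apart is -e^{dt}: χ is unchanged, the exponential gains e^{dt},
  -- and the sign changes because d is odd.
  term-shift : ∀ a → term (d +ℕ a) S.≈ (S.- e^ δ) S.* term a
  term-shift a = begin
    (S.- S.1#) S.^ (d +ℕ a) S.* const (χ (+ (d +ℕ a))) S.* e^ (fromℕ′ (d +ℕ a))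
      ≈⟨ S.*-cong (S.*-cong -1^[d+a] (const.⟦⟧-cong (χ-shift a)))
           (S.trans (e^-cong (×-homo-+ 1# d a)) (e^[a+b]≈e^a*e^b δ (fromℕ′ a))) ⟩
    ((S.- S.1#) S.* (S.- S.1#) S.^ a) S.* const (χ (+ a)) S.* (e^ δ S.* e^ (fromℕ′ a))
      ≈⟨ S.solve 5 (λ m q c E x → ((m S.:* q) S.:* c) S.:* (E S.:* x) S.:= (m S.:* E) S.:* ((q S.:* c) S.:* x))
           S.refl (S.- S.1#) ((S.- S.1#) S.^ a) (const (χ (+ a))) (e^ δ) (e^ (fromℕ′ a)) ⟩
    ((S.- S.1#) S.* e^ δ) S.* term a
      ≈⟨ S.*-congʳ (S.-1*x≈-x (e^ δ)) ⟩
    (S.- e^ δ) S.* term a ∎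
    where
    open S.≈-Reasoning
    module const = IsRingHomomorphism constSeries-isRingHomomorphism
    -1^[d+a] : (S.- S.1#) S.^ (d +ℕ a) S.≈ (S.- S.1#) S.* (S.- S.1#) S.^ a
    -1^[d+a] = S.trans (S.^-homo-* (S.- S.1#) d a)
      (S.*-congʳ (S.trans (S.[-x]^odd d d-odd S.1#) (S.-‿cong (S.1^n≈1 d))))

  -- This is the geometric sum with r = -e^{dt}. Since w is odd, r^w = -e^{wdt}, so 1 - r and 1 -
  -- r^w become e^{dt} + 1 and e^{wdt} + 1.
  Z-identity : ∀ w → ¬ 2 ∣ℕ w →
    (e^ δ S.+ S.1#) S.* Z w S.≈ S.∑ d term S.* (e^ (fromℕ′ w * δ) S.+ S.1#)
  Z-identity w w-odd = begin
    (e^ δ S.+ S.1#) S.* Z w                              ≈⟨ S.*-comm (e^ δ S.+ S.1#) (Z w) ⟩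
    Z w S.* (e^ δ S.+ S.1#)                              ≈⟨ S.*-congˡ {Z w} (1--x≈x+1 (e^ δ)) ⟨
    Z w S.* (S.1# S.- (S.- e^ δ))                        ≈⟨ S.geometric-∑ d (S.- e^ δ) term term-shift w ⟩
    S.∑ d term S.* (S.1# S.- (S.- e^ δ) S.^ w)           ≈⟨ S.*-congˡ {S.∑ d term} (S.+-congˡ (S.-‿cong [-e^δ]^w)) ⟩
    S.∑ d term S.* (S.1# S.- (S.- e^ (fromℕ′ w * δ)))    ≈⟨ S.*-congˡ {S.∑ d term} (1--x≈x+1 (e^ (fromℕ′ w * δ))) ⟩
    S.∑ d term S.* (e^ (fromℕ′ w * δ) S.+ S.1#)          ∎
    where
    open S.≈-Reasoning
    1--x≈x+1 : ∀ x → S.1# S.- (S.- x) S.≈ x S.+ S.1#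
    1--x≈x+1 x = S.trans (S.+-congˡ (S.-‿involutive x)) (S.+-comm S.1# x)
    [-e^δ]^w : (S.- e^ δ) S.^ w S.≈ S.- e^ (fromℕ′ w * δ)
    [-e^δ]^w = S.trans (S.[-x]^odd w w-odd (e^ δ)) (S.-‿cong (S.sym (e^[n*a]≈[e^a]^n δ w)))

  Z-coeff : ∀ w → ¬ 2 ∣ℕ w → ∀ l → Z w l ≈ l !⁻¹ * altPowerSum rawRing χ l (w *ℕ d ∸ 1)
  Z-coeff w w-odd l = begin
    Z w l                                       ≈⟨ ∑-pointwise (w *ℕ d) term l ⟩
    ∑ (w *ℕ d) (λ a → term a l)                 ≈⟨ ∑-cong (w *ℕ d) term-coeff ⟩
    ∑ (w *ℕ d) (λ a → l !⁻¹ * summand a)        ≈⟨ *-distribˡ-sum {w *ℕ d} (l !⁻¹) (summand ∘ toℕ) ⟨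
    l !⁻¹ * ∑ (w *ℕ d) summand                  ≡⟨ ≡.cong (λ m → l !⁻¹ * ∑ m summand) wd≡ ⟩
    l !⁻¹ * ∑ (suc (w *ℕ d ∸ 1)) summand        ∎
    where
    open ≈-Reasoning
    module const = IsRingHomomorphism constSeries-isRingHomomorphism
    module Const = Homomorphism rawRing seriesCommutativeRing const constSeries-isRingHomomorphism

    summand : ℕ → Carrier
    summand a = (- 1#) ^ a * χ (+ a) * fromℕ′ a ^ l

    -- The power sum runs up to wd - 1 inclusive. Truncated subtraction is harmless here since wd is
    -- positive, both factors being odd.
    wd≡ : w *ℕ d ≡ suc (w *ℕ d ∸ 1)
    wd≡ with odd⇒≡1+2* w w-odd | odd⇒≡1+2* d d-odd
    ... | _ , ≡.refl | _ , ≡.refl = ≡.refl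

    term-coeff : ∀ a → term a l ≈ l !⁻¹ * summand a
    term-coeff a = begin
      term a l
        ≈⟨ S.*-congʳ {e^ (fromℕ′ a)} (S.trans
             (S.*-congʳ {const (χ (+ a))} (S.trans (S.^-congˡ a (S.sym (const.-‿homo 1#))) (S.sym (Const.^-homo (- 1#) a))))
             (S.sym (const.*-homo ((- 1#) ^ a) (χ (+ a))))) l ⟩
      (const ((- 1#) ^ a * χ (+ a)) S.* e^ (fromℕ′ a)) l
        ≈⟨ constSeries-* ((- 1#) ^ a * χ (+ a)) (e^ (fromℕ′ a)) l ⟩
      (- 1#) ^ a * χ (+ a) * (l !⁻¹ * fromℕ′ a ^ l)
        ≈⟨ solve 3 (λ p f q → p :* (f :* q) := f :* (p :* q)) refl ((- 1#) ^ a * χ (+ a)) (l !⁻¹) (fromℕ′ a ^ l) ⟩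
      l !⁻¹ * summand a ∎

  -- The constant term is 2 whatever a is, so the single element ½ serves every denominator that
  -- occurs.
  [e^a+1]₀*½≈1 : ∀ a → (e^ a S.+ S.1#) 0 * ι ½ ≈ 1#
  [e^a+1]₀*½≈1 a = trans (*-comm _ _) (trans (*-congˡ (+-cong
    (trans (*-identityʳ _) (IsRingHomomorphism.1#-homo ι-hom)) (sym (+-identityʳ 1#)))) ½-inverse)

  -- The series of E_n(x) t^n / n!, with x already specialised to an element of K.
  ε : Carrier → S.Carrier
  ε x n = eval rawRing (eulerSeries rawRing ι d χ n) x

  module _ (x : Carrier) where
    open Evaluation K x
    private
      module ev = IsRingHomomorphism ev-isRingHomomorphism
      module Ev = Homomorphism (polyRing rawRing) K ev ev-isRingHomomorphism
      P[t] = seriesRing (polyRing rawRing)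
      module P[t] where
        open RawRing P[t] public
        open RawSemiringDefs (RawRing.rawSemiring P[t]) public using (_^_)
      Φ : P[t].Carrier → S.Carrier
      Φ f = ev ∘ f
      Φ-hom = mapSeries-isRingHomomorphism (polyRing rawRing) ev ev-isRingHomomorphism
      module φ = IsRingHomomorphism Φ-hom
      module Φ = Homomorphism P[t] seriesCommutativeRing Φ Φ-hom

      ιᴾ : ℚ → Poly rawRing
      ιᴾ q = constPoly rawRing (ι q)

      expᴾ : Poly rawRing → P[t].Carrier
      expᴾ = exp (polyRing rawRing) ιᴾ

      dᴾ : Poly rawRing
      dᴾ = fromℕ (polyRing rawRing) d

      -- These are the constituents of `eulerSeries`, restated so that they agree with it
      -- definitionally; `Φ` can then be pushed through them one by one.
      signᴾ charᴾ termᴾ : ℕ → P[t].Carrier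
      signᴾ a = (P[t].- P[t].1#) P[t].^ a
      charᴾ a = constSeries (polyRing rawRing) (constPoly rawRing (χ (+ a)))
      termᴾ a = signᴾ a P[t].* charᴾ a P[t].* expᴾ (fromℕ (polyRing rawRing) a)

      num den h : P[t].Carrier
      num = fromℕ P[t] 2 P[t].* expᴾ (X rawRing)
      den = expᴾ dᴾ P[t].+ P[t].1#
      h   = divide (polyRing rawRing) (ιᴾ ½) num den

      Φ-exp : ∀ f {a} → ev f ≈ a → Φ (expᴾ f) S.≈ e^ a
      Φ-exp f f≈a n = trans (ev.*-homo (constPoly rawRing (n !⁻¹)) (f ^ᴾ n))
        (*-cong (ev-const (n !⁻¹)) (trans (Ev.^-homo f n) (^-congˡ n f≈a)))
        where open RawSemiringDefs (RawRing.rawSemiring (polyRing rawRing)) renaming (_^_ to _^ᴾ_)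

      Φ-sign : ∀ a → Φ (signᴾ a) S.≈ (S.- S.1#) S.^ a
      Φ-sign a = S.trans (Φ.^-homo (P[t].- P[t].1#) a)
        (S.^-congˡ a (S.trans (φ.-‿homo P[t].1#) (S.-‿cong φ.1#-homo)))

      Φ-char : ∀ a → Φ (charᴾ a) S.≈ const (χ (+ a))
      Φ-char a zero    = ev-const (χ (+ a))
      Φ-char a (suc n) = refl

      Φ-term : ∀ a → Φ (termᴾ a) S.≈ term a
      Φ-term a = S.trans (φ.*-homo (signᴾ a P[t].* charᴾ a) (expᴾ (fromℕ (polyRing rawRing) a))) (S.*-cong
        (S.trans (φ.*-homo (signᴾ a) (charᴾ a)) (S.*-cong (Φ-sign a) (Φ-char a)))
        (Φ-exp (fromℕ (polyRing rawRing) a) (Ev.fromℕ-homo a)))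

      Φ-∑term : Φ (∑[_] P[t] d termᴾ) S.≈ S.∑ d term
      Φ-∑term = S.trans (Φ.sum-homo {d} (termᴾ ∘ toℕ)) (S.∑-cong d Φ-term)

      Φ-den : Φ den S.≈ e^ δ S.+ S.1#
      Φ-den = S.trans (φ.+-homo (expᴾ dᴾ) P[t].1#) (S.+-cong (Φ-exp dᴾ (Ev.fromℕ-homo d)) φ.1#-homo)

      Φ-num : Φ num S.≈ 2ˢ S.* e^ x
      Φ-num = S.trans (φ.*-homo (fromℕ P[t] 2) (expᴾ (X rawRing)))
        (S.*-cong (Φ.fromℕ-homo 2) (Φ-exp (X rawRing) ev-X))

    -- Evaluation turns the formal quotient `h` into a solution of `Φ den` times `Φ h` equals
    -- `Φ num`. Multiplying by A(t) gives the definition of the Euler polynomials with the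
    -- denominator cleared.
    ε-identity : (e^ δ S.+ S.1#) S.* ε x S.≈ 2ˢ S.* e^ x S.* S.∑ d term
    ε-identity = begin
      (e^ δ S.+ S.1#) S.* ε x
        ≈⟨ S.*-cong (S.sym Φ-den) (S.trans (φ.*-homo h (∑[_] P[t] d termᴾ)) (S.*-congˡ {Φ h} Φ-∑term)) ⟩
      Φ den S.* (Φ h S.* S.∑ d term)
        ≈⟨ S.*-assoc (Φ den) (Φ h) (S.∑ d term) ⟨
      Φ den S.* Φ h S.* S.∑ d term
        ≈⟨ S.*-congʳ {S.∑ d term} (S.trans (*-divide (polyRing rawRing) ev ev-isRingHomomorphism (ιᴾ ½) num den
             (trans (*-cong (Φ-den 0) (ev-const (ι ½))) ([e^a+1]₀*½≈1 δ))) Φ-num) ⟩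
      2ˢ S.* e^ x S.* S.∑ d term ∎
      where open S.≈-Reasoning

    eulerPoly-coeff : ∀ n → eval rawRing (eulerPoly rawRing ι d χ n) x ≈ fromℕ′ (n !) * ε x n
    eulerPoly-coeff n = trans (ev.*-homo (fromℕ (polyRing rawRing) (n !)) (eulerSeries rawRing ι d χ n))
      (*-congʳ (Ev.fromℕ-homo (n !)))

  -- Rescaled identities: `σ c` is A(ct) and `Q c` is the denominator e^{cdt} + 1

  Q σ : Carrier → S.Carrier
  Q c = e^ (c * δ) S.+ S.1#
  σ c = scale c (S.∑ d term)

  Q-cong : ∀ {a b} → a ≈ b → Q a S.≈ Q b
  Q-cong a≈b = S.+-congʳ (e^-cong (*-congʳ a≈b))

  -- `Q c` is a unit of K[[t]] because its constant term 2 is one of K.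
  Q-cancel : ∀ c {f g} → Q c S.* f S.≈ Q c S.* g → f S.≈ g
  Q-cancel c with h , Qh≈1 ← invertible (ι ½) (Q c) ([e^a+1]₀*½≈1 (c * δ)) = S.x*y≈1⇒*-cancelˡ {Q c} {h} Qh≈1

  scale-[e^a+1] : ∀ c a → scale c (e^ a S.+ S.1#) S.≈ e^ (c * a) S.+ S.1#
  scale-[e^a+1] c a = S.trans (scale.+-homo c (e^ a) S.1#) (S.+-cong (scale-e^ c a) (scale.1#-homo c))

  ε-scaled : ∀ c x → Q c S.* scale c (ε x) S.≈ 2ˢ S.* e^ (c * x) S.* σ c
  ε-scaled c x = begin
    Q c S.* scale c (ε x)                               ≈⟨ S.*-congʳ (scale-[e^a+1] c δ) ⟨
    scale c (e^ δ S.+ S.1#) S.* scale c (ε x)           ≈⟨ scale.*-homo c (e^ δ S.+ S.1#) (ε x) ⟨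
    scale c ((e^ δ S.+ S.1#) S.* ε x)                   ≈⟨ scale.⟦⟧-cong c (ε-identity x) ⟩
    scale c (2ˢ S.* e^ x S.* S.∑ d term)                ≈⟨ scale.*-homo c (2ˢ S.* e^ x) (S.∑ d term) ⟩
    scale c (2ˢ S.* e^ x) S.* σ c
      ≈⟨ S.*-congʳ {σ c} (S.trans (scale.*-homo c 2ˢ (e^ x)) (S.*-cong (Scale.fromℕ-homo c 2) (scale-e^ c x))) ⟩
    2ˢ S.* e^ (c * x) S.* σ c                           ∎
    where open S.≈-Reasoning

  Z-scaled : ∀ c w → ¬ 2 ∣ℕ w → Q c S.* scale c (Z w) S.≈ σ c S.* Q (c * fromℕ′ w)
  Z-scaled c w w-odd = begin
    Q c S.* scale c (Z w)                                       ≈⟨ S.*-congʳ (scale-[e^a+1] c δ) ⟨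
    scale c (e^ δ S.+ S.1#) S.* scale c (Z w)                   ≈⟨ scale.*-homo c (e^ δ S.+ S.1#) (Z w) ⟨
    scale c ((e^ δ S.+ S.1#) S.* Z w)                           ≈⟨ scale.⟦⟧-cong c (Z-identity w w-odd) ⟩
    scale c (S.∑ d term S.* (e^ (fromℕ′ w * δ) S.+ S.1#))       ≈⟨ scale.*-homo c (S.∑ d term) (e^ (fromℕ′ w * δ) S.+ S.1#) ⟩
    σ c S.* scale c (e^ (fromℕ′ w * δ) S.+ S.1#)
      ≈⟨ S.*-congˡ {σ c} (S.trans (scale-[e^a+1] c (fromℕ′ w * δ))
           (S.+-congʳ (e^-cong (sym (*-assoc c (fromℕ′ w) δ))))) ⟩
    σ c S.* Q (c * fromℕ′ w)                                    ∎
    where open S.≈-Reasoning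

  -- Each scale is the product of the two weights that do not belong to the factor, so its kth, lth
  -- or mth power yields the weights of the sum. The right-nested bracketing is that of a sum over k
  -- of sums over l.
  product : (w₁ w₂ w₃ : ℕ) → Carrier → S.Carrier
  product w₁ w₂ w₃ y =
    scale (fromℕ′ w₂ * fromℕ′ w₃) (ε (fromℕ′ w₁ * y)) S.*
    (scale (fromℕ′ w₃ * fromℕ′ w₁) (Z w₂) S.* scale (fromℕ′ w₁ * fromℕ′ w₂) (Z w₃))

  module _ (w₁ w₂ w₃ : ℕ) (y : Carrier) where
    private
      W₁ = fromℕ′ w₁
      W₂ = fromℕ′ w₂
      W₃ = fromℕ′ w₃
      a = W₂ * W₃
      b = W₃ * W₁
      c = W₁ * W₂
      N = W₁ * W₂ * W₃

    -- Each of `a`, `b`, `c` times its missing weight is `N`. Hence the Euler factor gives the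
    -- exponential of `N * y`, and each of the two power sums gives one `Q N`.
    product-identity : ¬ 2 ∣ℕ w₂ → ¬ 2 ∣ℕ w₃ →
      Q a S.* (Q b S.* (Q c S.* product w₁ w₂ w₃ y)) S.≈
      2ˢ S.* e^ (N * y) S.* (σ a S.* (σ b S.* σ c)) S.* (Q N S.* Q N)
    product-identity w₂-odd w₃-odd = begin
      Q a S.* (Q b S.* (Q c S.* product w₁ w₂ w₃ y))
        ≈⟨ S.solve 6 (λ q r s f g h → q S.:* (r S.:* (s S.:* (f S.:* (g S.:* h)))) S.:= (q S.:* f) S.:* ((r S.:* g) S.:* (s S.:* h)))
             S.refl (Q a) (Q b) (Q c) (scale a (ε (W₁ * y))) (scale b (Z w₂)) (scale c (Z w₃)) ⟩
      (Q a S.* scale a (ε (W₁ * y))) S.* ((Q b S.* scale b (Z w₂)) S.* (Q c S.* scale c (Z w₃)))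
        ≈⟨ S.*-cong
             (S.trans (ε-scaled a (W₁ * y)) (S.*-congʳ {σ a} (S.*-congˡ {2ˢ} (e^-cong
               (solve 4 (λ p q r y → (q :* r) :* (p :* y) := ((p :* q) :* r) :* y) refl W₁ W₂ W₃ y)))))
             (S.*-cong
               (S.trans (Z-scaled b w₂ w₂-odd) (S.*-congˡ {σ b} (Q-cong
                 (solve 3 (λ p q r → (r :* p) :* q := (p :* q) :* r) refl W₁ W₂ W₃))))
               (Z-scaled c w₃ w₃-odd)) ⟩
      (2ˢ S.* e^ (N * y) S.* σ a) S.* ((σ b S.* Q N) S.* (σ c S.* Q N))
        ≈⟨ S.solve 5 (λ e p q r n → (e S.:* p) S.:* ((q S.:* n) S.:* (r S.:* n)) S.:= (e S.:* (p S.:* (q S.:* r))) S.:* (n S.:* n))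
             S.refl (2ˢ S.* e^ (N * y)) (σ a) (σ b) (σ c) (Q N) ⟩
      2ˢ S.* e^ (N * y) S.* (σ a S.* (σ b S.* σ c)) S.* (Q N S.* Q N) ∎
      where open S.≈-Reasoning

  -- Rotating the weights turns `a`, `b`, `c` into `b`, `c`, `a` definitionally, and `N` into `N′`
  -- up to commutativity. The right-hand side of `product-identity` is unaffected, and the three
  -- units `Q a`, `Q b`, `Q c` cancel.
  product-rotate : ∀ w₁ w₂ w₃ y → ¬ 2 ∣ℕ w₁ → ¬ 2 ∣ℕ w₂ → ¬ 2 ∣ℕ w₃ →
    product w₁ w₂ w₃ y S.≈ product w₂ w₃ w₁ y
  product-rotate w₁ w₂ w₃ y w₁-odd w₂-odd w₃-odd = Q-cancel c (Q-cancel b (Q-cancel a (begin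
    Q a S.* (Q b S.* (Q c S.* product w₁ w₂ w₃ y))
      ≈⟨ product-identity w₁ w₂ w₃ y w₂-odd w₃-odd ⟩
    2ˢ S.* e^ (N * y) S.* (σ a S.* (σ b S.* σ c)) S.* (Q N S.* Q N)
      ≈⟨ S.*-cong
           (S.*-cong {2ˢ S.* e^ (N * y)} (S.*-congˡ {2ˢ} (e^-cong (*-congʳ N≈N′)))
             (S.solve 3 (λ p q r → p S.:* (q S.:* r) S.:= q S.:* (r S.:* p)) S.refl (σ a) (σ b) (σ c)))
           (S.*-cong (Q-cong N≈N′) (Q-cong N≈N′)) ⟩
    2ˢ S.* e^ (N′ * y) S.* (σ b S.* (σ c S.* σ a)) S.* (Q N′ S.* Q N′)
      ≈⟨ product-identity w₂ w₃ w₁ y w₃-odd w₁-odd ⟨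
    Q b S.* (Q c S.* (Q a S.* product w₂ w₃ w₁ y))
      ≈⟨ S.solve 4 (λ p q r f → q S.:* (r S.:* (p S.:* f)) S.:= p S.:* (q S.:* (r S.:* f))) S.refl (Q a) (Q b) (Q c) (product w₂ w₃ w₁ y) ⟩
    Q a S.* (Q b S.* (Q c S.* product w₂ w₃ w₁ y)) ∎)))
    where
    open S.≈-Reasoning
    W₁ = fromℕ′ w₁
    W₂ = fromℕ′ w₂
    W₃ = fromℕ′ w₃
    a = W₂ * W₃
    b = W₃ * W₁
    c = W₁ * W₂
    N = W₁ * W₂ * W₃
    N′ = W₂ * W₃ * W₁
    N≈N′ : N ≈ N′
    N≈N′ = solve 3 (λ p q r → (p :* q) :* r := (q :* r) :* p) refl W₁ W₂ W₃

  -- The sums of the theorem as coefficients of the product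

  mixedSum : (n w₁ w₂ w₃ : ℕ) → Carrier → Carrier
  mixedSum n w₁ w₂ w₃ y = ∑₃ rawRing n λ k l m →
    ι (multinomial n k l m) * eval rawRing (eulerPoly rawRing ι d χ k) (fromℕ′ w₁ * y)
      * altPowerSum rawRing χ l (w₂ *ℕ d ∸ 1) * altPowerSum rawRing χ m (w₃ *ℕ d ∸ 1)
      * fromℕ′ w₁ ^ (l +ℕ m) * fromℕ′ w₂ ^ (k +ℕ m) * fromℕ′ w₃ ^ (k +ℕ l)

  -- With m = n - k - l, `∑₃` is by definition the index set of the nested convolution A(BC), so it
  -- is enough to match the summands and to pull out n!.
  mixedSum≈n!*product : ∀ n w₁ w₂ w₃ y → ¬ 2 ∣ℕ w₂ → ¬ 2 ∣ℕ w₃ →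
    mixedSum n w₁ w₂ w₃ y ≈ fromℕ′ (n !) * product w₁ w₂ w₃ y n
  mixedSum≈n!*product n w₁ w₂ w₃ y w₂-odd w₃-odd = begin
    mixedSum n w₁ w₂ w₃ y
      ≈⟨ ∑-cong (suc n) (λ k → trans
           (∑-cong (suc (n ∸ k)) (λ l → summand≈ k l (n ∸ k ∸ l)))
           (trans (sym (*-distribˡ-sum {suc (n ∸ k)} (fromℕ′ (n !) * A k) (λ l → B (toℕ l) * C (n ∸ k ∸ toℕ l))))
                  (*-assoc _ _ _))) ⟩
    ∑ (suc n) (λ k → fromℕ′ (n !) * (A k * (B S.* C) (n ∸ k)))
      ≈⟨ *-distribˡ-sum {suc n} (fromℕ′ (n !)) (λ k → A (toℕ k) * (B S.* C) (n ∸ toℕ k)) ⟨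
    fromℕ′ (n !) * product w₁ w₂ w₃ y n ∎
    where
    open ≈-Reasoning
    W₁ = fromℕ′ w₁
    W₂ = fromℕ′ w₂
    W₃ = fromℕ′ w₃
    A = scale (W₂ * W₃) (ε (W₁ * y))
    B = scale (W₃ * W₁) (Z w₂)
    C = scale (W₁ * W₂) (Z w₃)
    E : ℕ → Carrier
    E k = eval rawRing (eulerPoly rawRing ι d χ k) (W₁ * y)
    T : ℕ → ℕ → Carrier
    T w l = altPowerSum rawRing χ l (w *ℕ d ∸ 1)

    summand≈ : ∀ k l m →
      ι (multinomial n k l m) * E k * T w₂ l * T w₃ m * W₁ ^ (l +ℕ m) * W₂ ^ (k +ℕ m) * W₃ ^ (k +ℕ l)
        ≈ fromℕ′ (n !) * A k * (B l * C m)
    summand≈ k l m = begin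
      M * E k * T₂ * T₃ * W₁ ^ (l +ℕ m) * W₂ ^ (k +ℕ m) * W₃ ^ (k +ℕ l)
        ≈⟨ *-cong (*-cong (*-cong (*-congʳ (*-congʳ (*-congˡ (eulerPoly-coeff (W₁ * y) k))))
             (^-homo-* W₁ l m)) (^-homo-* W₂ k m)) (^-homo-* W₃ k l) ⟩
      M * (k! * εk) * T₂ * T₃ * (W₁ ^ l * W₁ ^ m) * (W₂ ^ k * W₂ ^ m) * (W₃ ^ k * W₃ ^ l)
        -- The six powers are regrouped by exponent instead of by base, and k! moves next to the
        -- multinomial coefficient.
        ≈⟨ solve 11 (λ M k e t u p q r s v w →
             (((((M :* (k :* e)) :* t) :* u) :* (p :* q)) :* (r :* s)) :* (v :* w) :=
             (M :* k) :* ((((r :* v) :* e) :* (t :* (w :* p))) :* (u :* (q :* s))))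
             refl M k! εk T₂ T₃ (W₁ ^ l) (W₁ ^ m) (W₂ ^ k) (W₂ ^ m) (W₃ ^ k) (W₃ ^ l) ⟩
      M * k! * (W₂ ^ k * W₃ ^ k * εk * (T₂ * (W₃ ^ l * W₁ ^ l)) * (T₃ * (W₁ ^ m * W₂ ^ m)))
        ≈⟨ *-cong (multinomial-*-k! n k l m) (*-cong (*-cong
             (*-congʳ (sym (^-distrib-* W₂ W₃ k)))
             (*-congˡ (sym (^-distrib-* W₃ W₁ l))))
             (*-congˡ (sym (^-distrib-* W₁ W₂ m)))) ⟩
      n! * (l !⁻¹ * m !⁻¹) * (A k * (T₂ * (W₃ * W₁) ^ l) * (T₃ * (W₁ * W₂) ^ m))
        ≈⟨ solve 8 (λ n l m a t p u q → (n :* (l :* m)) :* ((a :* (t :* p)) :* (u :* q)) :=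
             (n :* a) :* ((p :* (l :* t)) :* (q :* (m :* u))))
             refl n! (l !⁻¹) (m !⁻¹) (A k) T₂ ((W₃ * W₁) ^ l) T₃ ((W₁ * W₂) ^ m) ⟩
      n! * A k * ((W₃ * W₁) ^ l * (l !⁻¹ * T₂) * ((W₁ * W₂) ^ m * (m !⁻¹ * T₃)))
        ≈⟨ *-congˡ (*-cong (*-congˡ (Z-coeff w₂ w₂-odd l)) (*-congˡ (Z-coeff w₃ w₃-odd m))) ⟨
      n! * A k * (B l * C m) ∎
      where
      M = ι (multinomial n k l m)
      n! = fromℕ′ (n !)
      k! = fromℕ′ (k !)
      εk = ε (W₁ * y) k
      T₂ = T w₂ l
      T₃ = T w₃ m

  mixedSum-rotate : ∀ n w₁ w₂ w₃ y → ¬ 2 ∣ℕ w₁ → ¬ 2 ∣ℕ w₂ → ¬ 2 ∣ℕ w₃ →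
    mixedSum n w₁ w₂ w₃ y ≈ mixedSum n w₂ w₃ w₁ y
  mixedSum-rotate n w₁ w₂ w₃ y w₁-odd w₂-odd w₃-odd = begin
    mixedSum n w₁ w₂ w₃ y                   ≈⟨ mixedSum≈n!*product n w₁ w₂ w₃ y w₂-odd w₃-odd ⟩
    fromℕ′ (n !) * product w₁ w₂ w₃ y n     ≈⟨ *-congˡ (product-rotate w₁ w₂ w₃ y w₁-odd w₂-odd w₃-odd n) ⟩
    fromℕ′ (n !) * product w₂ w₃ w₁ y n     ≈⟨ mixedSum≈n!*product n w₂ w₃ w₁ y w₃-odd w₁-odd ⟨
    mixedSum n w₂ w₃ w₁ y                   ∎
    where open ≈-Reasoning

-- Specialisation to ℂₚ

open Defs using (rawRing)

theorem4p4 :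
  ∀ {c ℓ₁ ℓ₂ c′ ℓ₁′ ℓ₂′}
  (p : ℕ) → Prime p → ¬ (2 ∣ℕ p) →
  (tower : PadicTower p c ℓ₁ ℓ₂) → let open PadicTower tower in
  (closure : AlgebraicClosureOfℚ c′ ℓ₁′ ℓ₂′) → let open AlgebraicClosureOfℚ closure in
  (ℚ̄→ℂₚ : FieldHom ℚ̄ ℂₚ) →
  (d : ℕ) → ¬ (2 ∣ℕ d) →
  (character : DirichletCharacter ℚ̄ d) → let open DirichletCharacter character in
  Primitive →
  (w₁ w₂ w₃ : ℕ) → ¬ (2 ∣ℕ w₁) → ¬ (2 ∣ℕ w₂) → ¬ (2 ∣ℕ w₃) →
  (n : ℕ) (y₁ : ℤₚ) →
  let C = rawRing ℂₚ
      open RawRing C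
      open RawSemiringDefs rawSemiring using (_^_)
      χ′ = λ a → map {F = ℚ̄} {G = ℂₚ} ℚ̄→ℂₚ (χ a)
      E : ℕ → Carrier → Carrier
      E k x = eval C (eulerPoly C ℚ→ℂₚ d χ′ k) x
      T : ℕ → ℕ → Carrier
      T k m = altPowerSum C χ′ k m
      binom : ℕ → ℕ → ℕ → Carrier
      binom k l m = ℚ→ℂₚ (multinomial n k l m)
      y = ℤₚ→ℂₚ y₁
      W₁ = fromℕ C w₁
      W₂ = fromℕ C w₂
      W₃ = fromℕ C w₃
      S₁ = ∑₃ C n (λ k l m →
        binom k l m * E k (W₁ * y) * T l (w₂ *ℕ d ∸ 1) * T m (w₃ *ℕ d ∸ 1)
          * W₁ ^ (l +ℕ m) * W₂ ^ (k +ℕ m) * W₃ ^ (k +ℕ l))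
      S₂ = ∑₃ C n (λ k l m →
        binom k l m * E k (W₂ * y) * T l (w₃ *ℕ d ∸ 1) * T m (w₁ *ℕ d ∸ 1)
          * W₂ ^ (l +ℕ m) * W₃ ^ (k +ℕ m) * W₁ ^ (k +ℕ l))
      S₃ = ∑₃ C n (λ k l m →
        binom k l m * E k (W₃ * y) * T l (w₁ *ℕ d ∸ 1) * T m (w₂ *ℕ d ∸ 1)
          * W₃ ^ (l +ℕ m) * W₁ ^ (k +ℕ m) * W₂ ^ (k +ℕ l))
  in S₁ ≈ S₂ × S₂ ≈ S₃
theorem4p4 p _ _ tower closure ℚ̄→ℂₚ d d-odd character _ w₁ w₂ w₃ w₁-odd w₂-odd w₃-odd n y₁ =
  mixedSum-rotate n w₁ w₂ w₃ y w₁-odd w₂-odd w₃-odd , mixedSum-rotate n w₂ w₃ w₁ y w₂-odd w₃-odd w₁-odd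
  where
  open PadicTower tower
  open AlgebraicClosureOfℚ closure
  open DirichletCharacter character
  K : CommutativeRing _ _
  K = HeytingCommutativeRing.commutativeRing (HeytingField.heytingCommutativeRing ℂₚ)
  y = ℤₚ→ℂₚ y₁
  module ℚ̄→ℂₚ = RingHomomorphism ℚ̄→ℂₚ

  ℚ→ℂₚ-isRingHomomorphism : IsRingHomomorphism (rawRing ℚ.heytingField) (rawRing ℂₚ) ℚ→ℂₚ
  ℚ→ℂₚ-isRingHomomorphism = Composition.isRingHomomorphism (CommutativeRing.trans K)
    (RingHomomorphism.isRingHomomorphism ℚ→ℚₚ)
    (Composition.isRingHomomorphism (CommutativeRing.trans K)
      (RingHomomorphism.isRingHomomorphism ℚₚ→ℚ̄ₚ)
      (RingHomomorphism.isRingHomomorphism ℚ̄ₚ→ℂₚ))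

  -- Divisibility in ℤ is divisibility of absolute values, so computing |(d + a) - a| = d is enough
  -- to obtain the shift by one period from the periodicity of χ.
  d∣[d+a]-a : ∀ a → + d ℤ.∣ + (d +ℕ a) ℤ.- + a
  d∣[d+a]-a a = ∣-reflexive (≡.sym (≡.cong ℤ.∣_∣ (≡.trans (ℤ.m-n≡m⊖n (d +ℕ a) a)
    (≡.trans (ℤ.⊖-≥ (ℕ.m≤n+m a d)) (≡.cong +_ (ℕ.m+n∸n≡m d a))))))

  open EulerSeries K ℚ→ℂₚ ℚ→ℂₚ-isRingHomomorphism d d-odd (ℚ̄→ℂₚ.⟦_⟧ ∘ χ)
    (λ a → ℚ̄→ℂₚ.⟦⟧-cong (χ-periodic _ _ (d∣[d+a]-a a)))
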